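{- There is no circulant weighing matrix of order $60$ and weight $36$; equivalently, there is no sequence $[a_0,\dots,a_{59}]$ with entries in $\{0,\pm1\}$, exactly $36$ nonzero entries, and $\sum_{i=0}^{59}a_ia_{i+s}=0$ for all $s=1,\dots,59$ (indices mod 60).
   Context: A weighing matrix of order $n$ and weight $w>0$ is an $n\times n$ matrix $W$ with entries in $\{0,\pm1\}$ such that $WW^T=wI$. A circulant matrix is one in which each row is the cyclic shift by one position to the right of the previous row. -}

module Defs where

open import Algebra.Properties.CommutativeMonoid.Sum using (sum)
open import Data.Bool.Base using (if_then_else_)
open import Data.Fin.Base using (Fin; toℕ)
import Data.Fin.Properties as Fin
open import Data.Integer.Base using (ℤ; +_; 0ℤ; 1ℤ; -1ℤ; _*_)
import Data.Integer.Properties as ℤ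
open import Data.Nat.Base using (ℕ; suc; _+_; _≤_; _<_; NonZero)
open import Data.Nat.DivMod using (_mod_)
open import Data.Product.Base using (_×_)
open import Data.Sum.Base using (_⊎_)
open import Data.Vec.Base using (count)
open import Data.Vec.Functional using (Vector; toVec)
open import Relation.Binary.PropositionalEquality.Core using (_≡_)
open import Relation.Nullary.Decidable using (does; ¬?)

infix 9 _ᵀ
infixl 7 _⊗_ _⋆_

Σ[_] : ∀ {n} → Vector ℤ n → ℤ
Σ[_] = sum ℤ.+-0-commutativeMonoid

Matrix : ℕ → Set
Matrix n = Fin n → Fin n → ℤ

_ᵀ : ∀ {n} → Matrix n → Matrix n
(A ᵀ) i j = A j i

_⊗_ : ∀ {n} → Matrix n → Matrix n → Matrix n
(A ⊗ B) i j = Σ[ (λ k → A i k * B k j) ]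

_⋆_ : ∀ {n} → ℤ → Matrix n → Matrix n
(c ⋆ A) i j = c * A i j

𝟙 : ∀ {n} → Matrix n
𝟙 i j = if does (i Fin.≟ j) then 1ℤ else 0ℤ

Ternary : ℤ → Set
Ternary x = x ≡ 0ℤ ⊎ x ≡ 1ℤ ⊎ x ≡ -1ℤ

record IsWeighing {n : ℕ} (w : ℕ) (W : Matrix n) : Set where
  field
    weight>0 : 0 < w
    ternary  : ∀ i j → Ternary (W i j)
    WWᵀ≡wI   : ∀ i j → (W ⊗ W ᵀ) i j ≡ (+ w ⋆ 𝟙) i j

-- The index i + s, reduced modulo n.
_⊕_ : ∀ {n} .{{_ : NonZero n}} → Fin n → ℕ → Fin n
_⊕_ {n} i s = (toℕ i + s) mod n

-- Row i′ immediately follows row i; the entry in column j of row i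
-- moves one column to the right, cyclically.
IsCirculant : ∀ {n} .{{_ : NonZero n}} → Matrix n → Set
IsCirculant {n} W =
  ∀ (i i′ : Fin n) → toℕ i′ ≡ suc (toℕ i) → ∀ j → W i′ (j ⊕ 1) ≡ W i j

IsCirculantWeighing : ∀ {n} .{{_ : NonZero n}} → ℕ → Matrix n → Set
IsCirculantWeighing w W = IsWeighing w W × IsCirculant W

#nonzero : ∀ {n} → Vector ℤ n → ℕ
#nonzero a = count (λ x → ¬? (x ℤ.≟ 0ℤ)) (toVec a)

record IsPerfectTernary {n : ℕ} .{{_ : NonZero n}} (w : ℕ) (a : Vector ℤ n) : Set where
  field
    ternary         : ∀ i → Ternary (a i)
    weight          : #nonzero a ≡ w
    autocorrelation : ∀ s → 1 ≤ s → s < n → Σ[ (λ i → a i * a (i ⊕ s)) ] ≡ 0ℤ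

{-# OPTIONS --safe #-}

-- Idea. A circulant weighing matrix is determined by its first row, so let f be a perfect
-- sequence of period 60. Folding f modulo a divisor of 60, with or without alternating signs,
-- gives an integer vector of norm 36 whose other (nega)cyclic autocorrelations vanish. Modulo 5
-- this leaves only ±6 in one place; looking modulo 4 at the alternating fold modulo 10, also the
-- fold modulo 10 is ±6 in one place. After a translation and a sign change, f is thus 1 on the
-- multiples of 10 and has sum 0 on each of the nine other classes modulo 10 (the columns).
-- As no nonzero element of F₃[C₁₀] has vanishing autocorrelations, the three sums
-- f j + f (30 + j) in a column agree modulo 3. The alternating column sums are twice an integer
-- vector of norm 9, for which 22 possibilities remain. This leaves few types of columns, and all
-- combinations are excluded by the equation A(g) A(g⁻¹) = 36, valid for A(x) = Σ f i xⁱ and all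
-- g with g⁶⁰ = 1 modulo a prime.

module Submission where

open import Defs
open import Algebra.Bundles using (AbelianGroup)
import Algebra.Properties.CommutativeSemigroup
import Algebra.Properties.Group
open import Data.Bool.Base using (Bool; true; false; T; _∧_; _∨_; not; if_then_else_)
open import Data.Bool.ListAction using (all)
open import Data.Bool.Properties using (∧-conicalˡ; ∧-conicalʳ)
open import Data.Empty using (⊥; ⊥-elim)
open import Data.Fin.Base as Fin using (Fin; zero; suc; toℕ; fromℕ<)
open import Data.Fin.Properties using (toℕ-injective; toℕ-fromℕ<; toℕ<n)
open import Data.Integer.Base using (ℤ; +_; -[1+_]; 0ℤ; 1ℤ; -1ℤ; ∣_∣; _+_; _*_; -_; _-_; _^_)
open import Data.Integer.DivMod using (_%ℕ_; _/ℕ_; a≡a%ℕn+[a/ℕn]*n; n%ℕd<d)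
import Data.Integer.Properties as ℤ
open import Data.Integer.Tactic.RingSolver using (solve-∀)
open import Data.List.Base using (List; []; _∷_; _∷ʳ_; _++_; map; zipWith; replicate; applyUpTo; concatMap; filterᵇ; foldr)
open import Data.List.Membership.Propositional using (_∈_)
open import Data.List.Properties using (map-applyUpTo)
open import Data.List.Relation.Binary.Pointwise using (Pointwise; []; _∷_)
open import Data.List.Relation.Unary.Any using (here; there)
open import Data.Nat.Base as ℕ using (ℕ; zero; suc; ⌊_/2⌋; _≤_; _<_; z≤n; s≤s; NonZero; _≡ᵇ_; _≤ᵇ_; _<ᵇ_)
open import Data.Nat.DivMod using (_%_; _/_; _mod_; m≡m%n+[m/n]*n; m%n<n; m<n⇒m%n≡m; m*n%n≡0; m%n%n≡m%n; [m+n]%n≡m%n; %-distribˡ-+)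
import Data.Nat.Properties as ℕ
import Data.Nat.Tactic.RingSolver as ℕSolver
open import Data.Product.Base using (_×_; _,_; ∃; proj₁; proj₂)
open import Data.Sum.Base using (_⊎_; inj₁; inj₂; [_,_]′)
open import Data.Unit.Base using (tt)
open import Data.Vec.Functional using (Vector)
open import Function.Base using (_∘_)
open import Relation.Binary.PropositionalEquality
open import Relation.Nullary.Decidable.Core using (yes; no)
open import Relation.Nullary.Negation.Core using (¬_; contradiction)

open Algebra.Properties.CommutativeSemigroup ℤ.+-commutativeSemigroup using (interchange)
open Algebra.Properties.CommutativeSemigroup ℕ.+-commutativeSemigroup using (x∙yz≈y∙xz)
open Algebra.Properties.Group (AbelianGroup.group ℤ.+-0-abelianGroup) using (∙-cancelˡ)

-- Sums

∑ : ℕ → (ℕ → ℤ) → ℤ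
∑ zero    x = 0ℤ
∑ (suc n) x = x 0 + ∑ n (x ∘ suc)

∑-cong< : ∀ n {x y} → (∀ i → i < n → x i ≡ y i) → ∑ n x ≡ ∑ n y
∑-cong< zero    eq = refl
∑-cong< (suc n) eq = cong₂ _+_ (eq 0 (s≤s z≤n)) (∑-cong< n λ i i<n → eq (suc i) (s≤s i<n))

∑-cong : ∀ n {x y} → (∀ i → x i ≡ y i) → ∑ n x ≡ ∑ n y
∑-cong n eq = ∑-cong< n λ i _ → eq i

∑-0 : ∀ n → ∑ n (λ _ → 0ℤ) ≡ 0ℤ
∑-0 zero    = refl
∑-0 (suc n) = trans (ℤ.+-identityˡ _) (∑-0 n)

∑-+ : ∀ n x y → ∑ n (λ i → x i + y i) ≡ ∑ n x + ∑ n y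
∑-+ zero    x y = refl
∑-+ (suc n) x y = trans (cong (_+_ (x 0 + y 0)) (∑-+ n (x ∘ suc) (y ∘ suc))) (interchange (x 0) (y 0) (∑ n (x ∘ suc)) (∑ n (y ∘ suc)))

∑-*ˡ : ∀ n c x → ∑ n (λ i → c * x i) ≡ c * ∑ n x
∑-*ˡ zero    c x = sym (ℤ.*-zeroʳ c)
∑-*ˡ (suc n) c x = trans (cong (_+_ (c * x 0)) (∑-*ˡ n c (x ∘ suc))) (sym (ℤ.*-distribˡ-+ c (x 0) _))

∑-*ʳ : ∀ n c x → ∑ n (λ i → x i * c) ≡ ∑ n x * c
∑-*ʳ n c x = trans (∑-cong n λ i → ℤ.*-comm (x i) c) (trans (∑-*ˡ n c x) (ℤ.*-comm c _))

∑-swap : ∀ m n (x : ℕ → ℕ → ℤ) → ∑ m (λ i → ∑ n (x i)) ≡ ∑ n (λ j → ∑ m (λ i → x i j))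
∑-swap zero    n x = sym (∑-0 n)
∑-swap (suc m) n x = trans (cong (_+_ (∑ n (x 0))) (∑-swap m n (x ∘ suc))) (sym (∑-+ n (x 0) _))

∑-∷ʳ : ∀ n x → ∑ (suc n) x ≡ ∑ n x + x n
∑-∷ʳ zero    x = ℤ.+-comm (x 0) 0ℤ
∑-∷ʳ (suc n) x = trans (cong (_+_ (x 0)) (∑-∷ʳ n (x ∘ suc))) (sym (ℤ.+-assoc (x 0) _ _))

∑-++ : ∀ m n x → ∑ (m ℕ.+ n) x ≡ ∑ m x + ∑ n (λ i → x (m ℕ.+ i))
∑-++ zero    n x = sym (ℤ.+-identityˡ _)
∑-++ (suc m) n x = trans (cong (_+_ (x 0)) (∑-++ m n (x ∘ suc))) (sym (ℤ.+-assoc (x 0) _ _))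

∑-blocks : ∀ m d x → ∑ (m ℕ.* d) x ≡ ∑ d (λ j → ∑ m (λ k → x (k ℕ.* d ℕ.+ j)))
∑-blocks zero    d x = sym (∑-0 d)
∑-blocks (suc m) d x = begin
  ∑ (d ℕ.+ m ℕ.* d) x
    ≡⟨ ∑-++ d (m ℕ.* d) x ⟩
  ∑ d x + ∑ (m ℕ.* d) (λ i → x (d ℕ.+ i))
    ≡⟨ cong (_+_ (∑ d x)) (∑-blocks m d λ i → x (d ℕ.+ i)) ⟩
  ∑ d x + ∑ d (λ j → ∑ m (λ k → x (d ℕ.+ (k ℕ.* d ℕ.+ j))))
    ≡⟨ ∑-+ d x _ ⟨
  ∑ d (λ j → x j + ∑ m (λ k → x (d ℕ.+ (k ℕ.* d ℕ.+ j))))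
    ≡⟨ ∑-cong d (λ j → cong (_+_ (x j)) (∑-cong m λ k → cong x (sym (ℕ.+-assoc d (k ℕ.* d) j)))) ⟩
  ∑ d (λ j → ∑ (suc m) (λ k → x (k ℕ.* d ℕ.+ j)))
    ∎
  where open ≡-Reasoning

-- Congruences

infix  4 _≈_[_]
infixr 4 _,_

-- The quotient is an explicit witness, so the basic rules are polynomial identities. Modulus 0 is
-- allowed and means equality; exact and modular statements thus share their proofs.
record _≈_[_] (x y : ℤ) (m : ℕ) : Set where
  constructor _,_
  field
    quotient : ℤ
    equation : x ≡ y + quotient * + m

module _ {m : ℕ} where

  ≈-reflexive : ∀ {x y} → x ≡ y → x ≈ y [ m ]
  ≈-reflexive {x} refl = 0ℤ , sym (ℤ.+-identityʳ x)

  ≈-refl : ∀ {x} → x ≈ x [ m ]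
  ≈-refl = ≈-reflexive refl

  ≈-sym : ∀ {x y} → x ≈ y [ m ] → y ≈ x [ m ]
  ≈-sym {y = y} (k , refl) = - k , lemma y k (+ m)
    where lemma : ∀ y k m → y ≡ y + k * m + - k * m
          lemma = solve-∀

  ≈-trans : ∀ {x y z} → x ≈ y [ m ] → y ≈ z [ m ] → x ≈ z [ m ]
  ≈-trans {z = z} (k , refl) (l , refl) = l + k , lemma z k l (+ m)
    where lemma : ∀ z k l m → z + l * m + k * m ≡ z + (l + k) * m
          lemma = solve-∀

  ≈-+ : ∀ {x y u v} → x ≈ y [ m ] → u ≈ v [ m ] → x + u ≈ y + v [ m ]
  ≈-+ {y = y} {v = v} (k , refl) (l , refl) = k + l , lemma y v k l (+ m)
    where lemma : ∀ y v k l m → (y + k * m) + (v + l * m) ≡ y + v + (k + l) * m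
          lemma = solve-∀

  ≈-* : ∀ {x y u v} → x ≈ y [ m ] → u ≈ v [ m ] → x * u ≈ y * v [ m ]
  ≈-* {y = y} {v = v} (k , refl) (l , refl) = k * v + y * l + k * l * + m , lemma y v k l (+ m)
    where lemma : ∀ y v k l m → (y + k * m) * (v + l * m) ≡ y * v + (k * v + y * l + k * l * m) * m
          lemma = solve-∀

  ≈-^ : ∀ {x y} n → x ≈ y [ m ] → x ^ n ≈ y ^ n [ m ]
  ≈-^ zero    eq = ≈-refl
  ≈-^ (suc n) eq = ≈-* eq (≈-^ n eq)

  ∑-≈ : ∀ n {x y} → (∀ i → x i ≈ y i [ m ]) → ∑ n x ≈ ∑ n y [ m ]
  ∑-≈ zero    eq = ≈-refl
  ∑-≈ (suc n) eq = ≈-+ (eq 0) (∑-≈ n (eq ∘ suc))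

  -- Each step of the rotation drops `x 0` and gains `x n`, which is congruent to it by periodicity.
  ∑-rotate-≈ : ∀ n s {x} → (∀ i → x (n ℕ.+ i) ≈ x i [ m ]) → ∑ n (λ i → x (s ℕ.+ i)) ≈ ∑ n x [ m ]
  ∑-rotate-≈ n zero        per = ≈-refl
  ∑-rotate-≈ n (suc s) {x} per = ≈-trans (∑-rotate-≈ n s {x ∘ suc} per′) rotate₁
    where
    per′ : ∀ i → x (suc (n ℕ.+ i)) ≈ x (suc i) [ m ]
    per′ i = ≈-trans (≈-reflexive (cong x (sym (ℕ.+-suc n i)))) (per (suc i))
    back : x n ≈ x 0 [ m ]
    back = ≈-trans (≈-reflexive (cong x (sym (ℕ.+-identityʳ n)))) (per 0)
    cancel : ∀ a b → a + b + - a ≡ b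
    cancel = solve-∀
    move : ∀ a b → b + a + - a ≡ b
    move = solve-∀
    rotate₁ : ∑ n (x ∘ suc) ≈ ∑ n x [ m ]
    rotate₁ = ≈-trans (≈-reflexive (sym (cancel (x 0) (∑ n (x ∘ suc)))))
             (≈-trans (≈-+ (≈-reflexive (∑-∷ʳ n x)) (≈-refl {x = - x 0}))
             (≈-trans (≈-+ (≈-+ (≈-refl {x = ∑ n x}) back) (≈-refl {x = - x 0})) (≈-reflexive (move (x 0) (∑ n x)))))

≈0⇒≡ : ∀ {x y} → x ≈ y [ 0 ] → x ≡ y
≈0⇒≡ {x} {y} (k , refl) = trans (cong (_+_ y) (ℤ.*-zeroʳ k)) (ℤ.+-identityʳ y)

∑-rotate : ∀ n s {x} → (∀ i → x (n ℕ.+ i) ≡ x i) → ∑ n (λ i → x (s ℕ.+ i)) ≡ ∑ n x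
∑-rotate n s {x} per = ≈0⇒≡ (∑-rotate-≈ n s {x} λ i → ≈-reflexive (per i))

-- Boolean searches

infixr 3 _⇒_

_⇒_ : Bool → Bool → Bool
a ⇒ b = if a then b else true

⇒-elim : ∀ {a b} → (a ⇒ b) ≡ true → a ≡ true → b ≡ true
⇒-elim eq refl = eq

≤⇒≤ᵇ≡true : ∀ {m n} → m ≤ n → (m ≤ᵇ n) ≡ true
≤⇒≤ᵇ≡true {m} {n} m≤n with m ≤ᵇ n | ℕ.≤⇒≤ᵇ m≤n
... | true | _ = refl

≡ᵇ-true : ∀ {m n} → m ≡ n → (m ≡ᵇ n) ≡ true
≡ᵇ-true {zero}  refl = refl
≡ᵇ-true {suc m} refl = ≡ᵇ-true {m} refl

≡ᵇ-sound : ∀ m n → (m ≡ᵇ n) ≡ true → m ≡ n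
≡ᵇ-sound m n eq = ℕ.≡ᵇ⇒≡ m n (subst T (sym eq) tt)

module _ {A : Set} where

  all-sound : ∀ (p : A → Bool) {x} xs → all p xs ≡ true → x ∈ xs → p x ≡ true
  all-sound p (x ∷ xs) eq (here refl) = ∧-conicalˡ _ _ eq
  all-sound p (x ∷ xs) eq (there x∈)  = all-sound p xs (∧-conicalʳ (p x) _ eq) x∈

  boxes : List (List A) → (List A → Bool) → Bool
  boxes []       k = k []
  boxes (D ∷ Ds) k = all (λ v → boxes Ds (λ vs → k (v ∷ vs))) D

  boxes-sound : ∀ {Ds vs} k → boxes Ds k ≡ true → Pointwise _∈_ vs Ds → k vs ≡ true
  boxes-sound k eq [] = eq
  boxes-sound {D ∷ Ds} {v ∷ vs} k eq (v∈ ∷ vs∈) =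
    boxes-sound (λ vs → k (v ∷ vs)) (all-sound (λ v → boxes Ds (λ vs → k (v ∷ vs))) D eq v∈) vs∈

below : ℕ → (ℕ → Bool) → Bool
below zero    p = true
below (suc n) p = p 0 ∧ below n (p ∘ suc)

below-sound : ∀ n p → below n p ≡ true → ∀ i → i < n → p i ≡ true
below-sound (suc n) p eq zero    _         = ∧-conicalˡ _ _ eq
below-sound (suc n) p eq (suc i) (s≤s i<n) = below-sound n (p ∘ suc) (∧-conicalʳ (p 0) _ eq) i i<n

-- One coordinate of `sphere`: `k` receives each `v` with ∣v∣ ≤ a and v² ≤ b, together with the norm
-- b - v² left for the other coordinates.
level : ℕ → ℕ → (ℤ → ℕ → Bool) → Bool
level zero    b k = k 0ℤ b
level (suc a) b k =
  (suc a ℕ.* suc a ≤ᵇ b ⇒ k (+ suc a) (b ℕ.∸ suc a ℕ.* suc a) ∧ k -[1+ a ] (b ℕ.∸ suc a ℕ.* suc a))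
  ∧ level a b k

level-sound : ∀ a b k → level a b k ≡ true → ∀ v → ∣ v ∣ ≤ a → ∣ v ∣ ℕ.* ∣ v ∣ ≤ b →
              k v (b ℕ.∸ ∣ v ∣ ℕ.* ∣ v ∣) ≡ true
level-sound zero    b k eq (+ zero) z≤n _ = eq
level-sound (suc a) b k eq v v≤a v²≤b with ℕ.m≤n⇒m<n∨m≡n v≤a
... | inj₁ (s≤s v≤a′) = level-sound a b k (∧-conicalʳ _ _ eq) v v≤a′ v²≤b
level-sound (suc a) b k eq (+ _)    v≤a v²≤b | inj₂ refl =
  ∧-conicalˡ _ _ (⇒-elim (∧-conicalˡ _ (level a b k) eq) (≤⇒≤ᵇ≡true v²≤b))
level-sound (suc a) b k eq -[1+ _ ] v≤a v²≤b | inj₂ refl =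
  ∧-conicalʳ (k (+ suc a) _) _ (⇒-elim (∧-conicalˡ _ (level a b k) eq) (≤⇒≤ᵇ≡true v²≤b))

-- All integer vectors of length n and norm b, provided that b < (1 + a)².
sphere : ℕ → ℕ → ℕ → (List ℤ → Bool) → Bool
sphere a zero    zero    k = k []
sphere a zero    (suc b) k = true
sphere a (suc n) b       k = level a b λ v r → sphere a n r λ vs → k (v ∷ vs)

norm : ℕ → (ℕ → ℤ) → ℕ
norm zero    x = 0
norm (suc n) x = ∣ x 0 ∣ ℕ.* ∣ x 0 ∣ ℕ.+ norm n (x ∘ suc)

square : ∀ i → i * i ≡ + (∣ i ∣ ℕ.* ∣ i ∣)
square (+ n)    = sym (ℤ.pos-* n n)
square -[1+ n ] = refl

∑-squares : ∀ n x → ∑ n (λ i → x i * x i) ≡ + norm n x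
∑-squares zero    x = refl
∑-squares (suc n) x = cong₂ _+_ (square (x 0)) (∑-squares n (x ∘ suc))

sphere-sound : ∀ a n b k → sphere a n b k ≡ true → b < suc a ℕ.* suc a →
               ∀ x → norm n x ≡ b → k (applyUpTo x n) ≡ true
sphere-sound a zero    _ k eq _ x refl = eq
sphere-sound a (suc n) b k eq b< x refl =
  sphere-sound a n (b ℕ.∸ q) (λ vs → k (x 0 ∷ vs)) eq′
    (ℕ.≤-<-trans (ℕ.m∸n≤m b q) b<) (x ∘ suc) (sym (ℕ.m+n∸m≡n q _))
  where
  q = ∣ x 0 ∣ ℕ.* ∣ x 0 ∣
  q≤b : q ≤ b
  q≤b = ℕ.m≤m+n q _
  -- A larger entry would have square at least (1 + a)², which exceeds `b`.
  x≤a : ∣ x 0 ∣ ≤ a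
  x≤a with ∣ x 0 ∣ ℕ.≤? a
  ... | yes ≤a = ≤a
  ... | no  ≰a = contradiction (ℕ.≤-<-trans q≤b b<) (ℕ.≤⇒≯ (ℕ.*-mono-≤ (ℕ.≰⇒> ≰a) (ℕ.≰⇒> ≰a)))
  eq′ = level-sound a b (λ v r → sphere a n r λ vs → k (v ∷ vs)) eq (x 0) x≤a q≤b

∨-elim : ∀ a {b} → (a ∨ b) ≡ true → a ≡ true ⊎ b ≡ true
∨-elim true  _  = inj₁ refl
∨-elim false eq = inj₂ eq

not-true : ∀ {a} → not a ≡ true → ¬ a ≡ true
not-true () refl

∧-elim : ∀ a {b} → (a ∧ b) ≡ true → a ≡ true × b ≡ true
∧-elim true eq = refl , eq

applyUpTo-cong< : ∀ {A : Set} n {x y : ℕ → A} → (∀ i → i < n → x i ≡ y i) → applyUpTo x n ≡ applyUpTo y n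
applyUpTo-cong< zero    eq = refl
applyUpTo-cong< (suc n) eq = cong₂ _∷_ (eq 0 (s≤s z≤n)) (applyUpTo-cong< n λ i i<n → eq (suc i) (s≤s i<n))

all-applyUpTo : ∀ {A : Set} (p : A → Bool) x n → all p (applyUpTo x n) ≡ true → ∀ i → i < n → p (x i) ≡ true
all-applyUpTo p x (suc n) eq zero    _         = ∧-conicalˡ _ _ eq
all-applyUpTo p x (suc n) eq (suc i) (s≤s i<n) = all-applyUpTo p (x ∘ suc) n (∧-conicalʳ (p (x 0)) _ eq) i i<n

pointwise< : ∀ {A B : Set} {R : A → B → Set} n {x y} → (∀ i → i < n → R (x i) (y i)) → Pointwise R (applyUpTo x n) (applyUpTo y n)
pointwise< zero    r = []
pointwise< (suc n) r = r 0 (s≤s z≤n) ∷ pointwise< n λ i i<n → r (suc i) (s≤s i<n)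

at : List ℤ → ℕ → ℤ
at []       i       = 0ℤ
at (a ∷ as) zero    = a
at (a ∷ as) (suc i) = at as i

at-applyUpTo : ∀ x n i → i < n → at (applyUpTo x n) i ≡ x i
at-applyUpTo x (suc n) zero    _         = refl
at-applyUpTo x (suc n) (suc i) (s≤s i<n) = at-applyUpTo (x ∘ suc) n i i<n

-- Twisted rotations of lists and their autocorrelations

dot : List ℤ → List ℤ → ℤ
dot (a ∷ as) (b ∷ bs) = a * b + dot as bs
dot _        _        = 0ℤ

rot : ℤ → List ℤ → List ℤ
rot σ []       = []
rot σ (a ∷ as) = as ∷ʳ σ * a

infixr 5 _∷_

-- Searches run on lists and the theory on functions; this relates the two up to multiples of `m`,
-- so that one flatness lemma serves exact vectors and vectors of residues.
data Approx (m : ℕ) : List ℤ → (ℕ → ℤ) → ℕ → Set where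
  []  : ∀ {x} → Approx m [] x 0
  _∷_ : ∀ {a as x n} → a ≈ x 0 [ m ] → Approx m as (x ∘ suc) n → Approx m (a ∷ as) x (suc n)

module _ {m : ℕ} where

  exact : ∀ x n → Approx m (applyUpTo x n) x n
  exact x zero    = []
  exact x (suc n) = ≈-refl ∷ exact (x ∘ suc) n

  dot-≈ : ∀ {as bs x y n} → Approx m as x n → Approx m bs y n → dot as bs ≈ ∑ n (λ i → x i * y i) [ m ]
  dot-≈ []       []       = ≈-refl
  dot-≈ (p ∷ ps) (q ∷ qs) = ≈-+ (≈-* p q) (dot-≈ ps qs)

  snoc : ∀ {as a x n} → Approx m as x n → a ≈ x n [ m ] → Approx m (as ∷ʳ a) x (suc n)
  snoc []       q = q ∷ []
  snoc (p ∷ ps) q = p ∷ snoc ps q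

  rot-≈ : ∀ {σ as x n} → (∀ i → x (n ℕ.+ i) ≈ σ * x i [ m ]) → Approx m as x n → Approx m (rot σ as) (x ∘ suc) n
  rot-≈ per [] = []
  rot-≈ {σ} {x = x} {n = suc n} per (p ∷ ps) =
    snoc ps (≈-trans (≈-* (≈-refl {x = σ}) p) (≈-trans (≈-sym (per 0)) (≈-reflexive (cong (x ∘ suc) (ℕ.+-identityʳ n)))))

module _ (z : ℤ → Bool) (σ : ℤ) where

  -- `z` tests for zero, exactly or modulo a number; `rot σ` makes the autocorrelations cyclic for σ
  -- = 1 and negacyclic for σ = -1. `flatFrom as as` begins at shift 0, `flat` at shift 1.
  flatFrom : List ℤ → List ℤ → ℕ → Bool
  flatFrom as bs zero    = true
  flatFrom as bs (suc h) = z (dot as bs) ∧ flatFrom as (rot σ bs) h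

  flat : ℕ → List ℤ → Bool
  flat h as = flatFrom as (rot σ as) h

  module _ {m : ℕ} (z-true : ∀ {v} → v ≈ 0ℤ [ m ] → z v ≡ true) where

    flatFrom-true : ∀ {as bs x y n} h → Approx m as x n → Approx m bs y n →
                    (∀ i → y (n ℕ.+ i) ≈ σ * y i [ m ]) →
                    (∀ s → s < h → ∑ n (λ i → x i * y (s ℕ.+ i)) ≈ 0ℤ [ m ]) →
                    flatFrom as bs h ≡ true
    flatFrom-true zero ps qs per corr = refl
    flatFrom-true {y = y} {n = n} (suc h) ps qs per corr =
      cong₂ _∧_ (z-true (≈-trans (dot-≈ ps qs) (corr 0 (s≤s z≤n))))
        (flatFrom-true h ps (rot-≈ per qs)
          (λ i → ≈-trans (≈-reflexive (cong y (sym (ℕ.+-suc n i)))) (per (suc i)))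
          (λ s s<h → corr (suc s) (s≤s s<h)))

    flat-true : ∀ {as x n} h → Approx m as x n → (∀ i → x (n ℕ.+ i) ≈ σ * x i [ m ]) →
                (∀ s → s < h → ∑ n (λ i → x i * x (suc s ℕ.+ i)) ≈ 0ℤ [ m ]) →
                flat h as ≡ true
    flat-true {x = x} {n = n} h ps per corr = flatFrom-true h ps (rot-≈ per ps)
      (λ i → ≈-trans (≈-reflexive (cong x (sym (ℕ.+-suc n i)))) (per (suc i))) corr

isZero : ℤ → Bool
isZero (+ 0) = true
isZero _     = false

isZero-true : ∀ {v} → v ≈ 0ℤ [ 0 ] → isZero v ≡ true
isZero-true {v} v≈0 with v | ≈0⇒≡ v≈0
... | _ | refl = refl

isZero-sound : ∀ v → isZero v ≡ true → v ≡ 0ℤ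
isZero-sound (+ 0) _ = refl

divides : (m : ℕ) .{{_ : NonZero m}} → ℤ → Bool
divides m v = ∣ v ∣ % m ≡ᵇ 0

divides-true : ∀ m .{{_ : NonZero m}} {v} → v ≈ 0ℤ [ m ] → divides m v ≡ true
divides-true m {v} (k , refl) = ≡ᵇ-true
  (trans (cong (λ i → ∣ i ∣ % m) (ℤ.+-identityˡ (k * + m)))
  (trans (cong (_% m) (ℤ.abs-* k (+ m))) (m*n%n≡0 ∣ k ∣ m)))

equal : List ℤ → List ℤ → Bool
equal []       []       = true
equal (a ∷ as) (b ∷ bs) = isZero (a - b) ∧ equal as bs
equal _        _        = false

equal-sound : ∀ as bs → equal as bs ≡ true → as ≡ bs
equal-sound []       []       _  = refl
equal-sound (a ∷ as) (b ∷ bs) eq = cong₂ _∷_ (ℤ.i-j≡0⇒i≡j a b (isZero-sound _ (∧-conicalˡ _ _ eq)))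
                                             (equal-sound as bs (∧-conicalʳ (isZero (a - b)) _ eq))

-- Perfect sequences

spread : ∀ d .{{_ : NonZero d}} (P : ℕ → Set) → (∀ i → i < d → P i) → (∀ i → P i → P (d ℕ.+ i)) → ∀ i → P i
spread d P base step i =
  subst P (trans (ℕ.+-comm (i / d ℕ.* d) (i % d)) (sym (m≡m%n+[m/n]*n i d))) (climb (i / d))
  where
  climb : ∀ k → P (k ℕ.* d ℕ.+ i % d)
  climb zero    = base (i % d) (m%n<n i d)
  climb (suc k) = subst P (sym (ℕ.+-assoc d (k ℕ.* d) (i % d))) (step _ (climb k))

autocorrelation : ℕ → (ℕ → ℤ) → ℕ → ℤ
autocorrelation n x s = ∑ n λ i → x i * x (s ℕ.+ i)

peak : (n w : ℕ) .{{_ : NonZero n}} → ℕ → ℤ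
peak n w s = if s % n ≡ᵇ 0 then + w else 0ℤ

-- Finite sequences are extended periodically to ℕ.
record Perfect (n w : ℕ) .{{_ : NonZero n}} (f : ℕ → ℤ) : Set where
  field
    ternary     : ∀ i → Ternary (f i)
    periodic    : ∀ i → f (n ℕ.+ i) ≡ f i
    correlation : ∀ s → autocorrelation n f s ≡ peak n w s

translate : ∀ {n w} .{{_ : NonZero n}} {f} t → Perfect n w f → Perfect n w (λ i → f (t ℕ.+ i))
translate {n} {f = f} t P = record
  { ternary     = λ i → ternary (t ℕ.+ i)
  ; periodic    = λ i → trans (cong f (x∙yz≈y∙xz t n i)) (periodic (t ℕ.+ i))
  ; correlation = λ s → trans
      (∑-cong n λ i → cong (λ j → f (t ℕ.+ i) * f j) (x∙yz≈y∙xz t s i))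
      (trans (∑-rotate n t λ i → cong₂ _*_ (periodic i) (trans (cong f (x∙yz≈y∙xz s n i)) (periodic (s ℕ.+ i))))
             (correlation s))
  }
  where open Perfect P

negate : ∀ {n w} .{{_ : NonZero n}} {f} → Perfect n w f → Perfect n w (-_ ∘ f)
negate {n} {f = f} P = record
  { ternary     = λ i → neg (ternary i)
  ; periodic    = λ i → cong -_ (periodic i)
  ; correlation = λ s → trans (∑-cong n λ i → neg-* (f i) (f (s ℕ.+ i))) (correlation s)
  }
  where
  open Perfect P
  neg : ∀ {x} → Ternary x → Ternary (- x)
  neg (inj₁ refl)        = inj₁ refl
  neg (inj₂ (inj₁ refl)) = inj₂ (inj₂ refl)
  neg (inj₂ (inj₂ refl)) = inj₂ (inj₁ refl)
  neg-* : ∀ x y → - x * - y ≡ x * y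
  neg-* = solve-∀

-- Folding, that is, reducing Σ f i xⁱ modulo x^d - σ

fold : ℕ → ℕ → ℤ → (ℕ → ℤ) → ℕ → ℤ
fold m d σ f j = ∑ m λ k → σ ^ k * f (k ℕ.* d ℕ.+ j)

module Fold {n w} .{{_ : NonZero n}} {f} (P : Perfect n w f) (m d : ℕ) (md≡n : m ℕ.* d ≡ n)
            (σ : ℤ) (σσ≡1 : σ * σ ≡ 1ℤ) (σ^m≡1 : σ ^ m ≡ 1ℤ) where

  open Perfect P

  F : ℕ → ℤ
  F = fold m d σ f

  private
    g : ℕ → ℕ → ℤ
    g j k = σ ^ k * f (k ℕ.* d ℕ.+ j)

    g-periodic : ∀ j k → g j (m ℕ.+ k) ≡ g j k
    g-periodic j k = cong₂ _*_
      (trans (ℤ.^-distribˡ-+-* σ m k) (trans (cong (_* σ ^ k) σ^m≡1) (ℤ.*-identityˡ _)))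
      (trans (cong f index) (periodic _))
      where
      index : (m ℕ.+ k) ℕ.* d ℕ.+ j ≡ n ℕ.+ (k ℕ.* d ℕ.+ j)
      index = trans (cong (ℕ._+ j) (trans (ℕ.*-distribʳ-+ d m k) (cong (ℕ._+ k ℕ.* d) md≡n)))
                    (ℕ.+-assoc n (k ℕ.* d) j)

    -- A factor σ moves each summand to the next `k`; the summands are periodic in `k` because σ^m =
    -- 1.
    untwist : ∀ j → σ * F (d ℕ.+ j) ≡ F j
    untwist j = begin
      σ * F (d ℕ.+ j)                                          ≡⟨ ∑-*ˡ m σ _ ⟨
      ∑ m (λ k → σ * (σ ^ k * f (k ℕ.* d ℕ.+ (d ℕ.+ j))))      ≡⟨ ∑-cong m step ⟩
      ∑ m (λ k → g j (1 ℕ.+ k))                                ≡⟨ ∑-rotate m 1 (g-periodic j) ⟩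
      F j                                                      ∎
      where
      open ≡-Reasoning
      step : ∀ k → σ * (σ ^ k * f (k ℕ.* d ℕ.+ (d ℕ.+ j))) ≡ g j (1 ℕ.+ k)
      step k = trans (sym (ℤ.*-assoc σ (σ ^ k) _))
        (cong (λ i → σ * σ ^ k * f i) (trans (x∙yz≈y∙xz (k ℕ.* d) d j) (sym (ℕ.+-assoc d (k ℕ.* d) j))))

  F-twisted : ∀ j → F (d ℕ.+ j) ≡ σ * F j
  F-twisted j = begin
    F (d ℕ.+ j)              ≡⟨ ℤ.*-identityˡ _ ⟨
    1ℤ * F (d ℕ.+ j)         ≡⟨ cong (_* F (d ℕ.+ j)) σσ≡1 ⟨
    σ * σ * F (d ℕ.+ j)      ≡⟨ ℤ.*-assoc σ σ _ ⟩
    σ * (σ * F (d ℕ.+ j))    ≡⟨ cong (σ *_) (untwist j) ⟩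
    σ * F j                  ∎
    where open ≡-Reasoning

  private
    F-twisted^ : ∀ k j → F (k ℕ.* d ℕ.+ j) ≡ σ ^ k * F j
    F-twisted^ zero    j = sym (ℤ.*-identityˡ _)
    F-twisted^ (suc k) j = trans (cong F (ℕ.+-assoc d (k ℕ.* d) j))
      (trans (F-twisted _) (trans (cong (σ *_) (F-twisted^ k j)) (sym (ℤ.*-assoc σ (σ ^ k) _))))

    absorb : ∀ s j k → g j k * F (s ℕ.+ j) ≡ f (k ℕ.* d ℕ.+ j) * F (s ℕ.+ (k ℕ.* d ℕ.+ j))
    absorb s j k = trans (lemma (σ ^ k) _ _) (cong (f (k ℕ.* d ℕ.+ j) *_)
      (trans (sym (F-twisted^ k _)) (cong F (x∙yz≈y∙xz (k ℕ.* d) s j))))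
      where
      lemma : ∀ a b c → a * b * c ≡ b * (a * c)
      lemma = solve-∀

    expand : ∀ s i l → f i * g (s ℕ.+ i) l ≡ σ ^ l * (f i * f (l ℕ.* d ℕ.+ s ℕ.+ i))
    expand s i l = trans (lemma (f i) (σ ^ l) _)
      (cong (λ j → σ ^ l * (f i * f j)) (sym (ℕ.+-assoc (l ℕ.* d) s i)))
      where
      lemma : ∀ a b c → a * (b * c) ≡ b * (a * c)
      lemma = solve-∀

  -- Reduction modulo x^d - σ is a ring homomorphism on ℤ[x]/(xⁿ - 1), so autocorrelations of the
  -- fold are folds of autocorrelations. Concretely, twisted periodicity joins the blocks of the
  -- first factor into one sum over a full period; then the second factor is expanded.
  F-correlation : ∀ s → autocorrelation d F s ≡ ∑ m (λ l → σ ^ l * peak n w (l ℕ.* d ℕ.+ s))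
  F-correlation s = begin
    ∑ d (λ j → F j * F (s ℕ.+ j))
      ≡⟨ ∑-cong d (λ j → ∑-*ʳ m (F (s ℕ.+ j)) (g j)) ⟨
    ∑ d (λ j → ∑ m (λ k → g j k * F (s ℕ.+ j)))
      ≡⟨ ∑-cong d (λ j → ∑-cong m (absorb s j)) ⟩
    ∑ d (λ j → ∑ m (λ k → h (k ℕ.* d ℕ.+ j)))
      ≡⟨ ∑-blocks m d h ⟨
    ∑ (m ℕ.* d) h
      ≡⟨ cong (λ k → ∑ k h) md≡n ⟩
    ∑ n h
      ≡⟨ ∑-cong n (λ i → ∑-*ˡ m (f i) (g (s ℕ.+ i))) ⟨
    ∑ n (λ i → ∑ m (λ l → f i * g (s ℕ.+ i) l))
      ≡⟨ ∑-cong n (λ i → ∑-cong m (expand s i)) ⟩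
    ∑ n (λ i → ∑ m (λ l → σ ^ l * (f i * f (l ℕ.* d ℕ.+ s ℕ.+ i))))
      ≡⟨ ∑-swap n m (λ i l → σ ^ l * (f i * f (l ℕ.* d ℕ.+ s ℕ.+ i))) ⟩
    ∑ m (λ l → ∑ n (λ i → σ ^ l * (f i * f (l ℕ.* d ℕ.+ s ℕ.+ i))))
      ≡⟨ ∑-cong m (λ l → ∑-*ˡ n (σ ^ l) (λ i → f i * f (l ℕ.* d ℕ.+ s ℕ.+ i))) ⟩
    ∑ m (λ l → σ ^ l * autocorrelation n f (l ℕ.* d ℕ.+ s))
      ≡⟨ ∑-cong m (λ l → cong (σ ^ l *_) (correlation (l ℕ.* d ℕ.+ s))) ⟩
    ∑ m (λ l → σ ^ l * peak n w (l ℕ.* d ℕ.+ s))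
      ∎
    where
    open ≡-Reasoning
    h : ℕ → ℤ
    h i = f i * F (s ℕ.+ i)

  F-norm : ∀ b → ∑ m (λ l → σ ^ l * peak n w (l ℕ.* d ℕ.+ 0)) ≡ + b → norm d F ≡ b
  F-norm b eq = ℤ.+-injective (trans (sym (∑-squares d F)) (trans (F-correlation 0) eq))

  F-flat : ∀ {q} (z : ℤ → Bool) → (∀ {v} → v ≈ 0ℤ [ q ] → z v ≡ true) → ∀ h →
           below h (λ s → isZero (∑ m λ l → σ ^ l * peak n w (l ℕ.* d ℕ.+ suc s))) ≡ true →
           ∀ {vs} → Approx q vs F d → flat z σ h vs ≡ true
  F-flat z z-true h eq vs≈ = flat-true z σ z-true h vs≈ (λ i → ≈-reflexive (F-twisted i)) λ s s<h →
    ≈-reflexive (trans (F-correlation (suc s)) (isZero-sound _ (below-sound h _ eq s s<h)))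

-- The equation A(g) A(g⁻¹) = w modulo q

module Character {n w} .{{_ : NonZero n}} {f} (P : Perfect n w f) (q : ℕ) (g h : ℤ)
                 (g^n≈1 : g ^ n ≈ 1ℤ [ q ]) (gh≈1 : g * h ≈ 1ℤ [ q ]) where

  open Perfect P

  transform : ℤ → ℤ
  transform c = ∑ n λ i → f i * c ^ i

  private
    1^ : ∀ k → 1ℤ ^ k ≡ 1ℤ
    1^ = ℤ.^-zeroˡ

    ^-* : ∀ k → g ^ k * h ^ k ≡ (g * h) ^ k
    ^-* zero    = refl
    ^-* (suc k) = trans (lemma g h (g ^ k) (h ^ k)) (cong (g * h *_) (^-* k))
      where
      lemma : ∀ a b c d → a * c * (b * d) ≡ a * b * (c * d)
      lemma = solve-∀

    wrap : ∀ i → f (n ℕ.+ i) * g ^ (n ℕ.+ i) ≈ f i * g ^ i [ q ]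
    wrap i = ≈-* (≈-reflexive (periodic i))
      (≈-trans (≈-reflexive (ℤ.^-distribˡ-+-* g n i))
      (≈-trans (≈-* g^n≈1 (≈-refl {x = g ^ i})) (≈-reflexive (ℤ.*-identityˡ (g ^ i)))))

    cancel : ∀ i s → f (s ℕ.+ i) * g ^ (s ℕ.+ i) * (f i * h ^ i) ≈ g ^ s * (f i * f (s ℕ.+ i)) [ q ]
    cancel i s =
      ≈-trans (≈-reflexive (trans (cong (λ c → f (s ℕ.+ i) * c * (f i * h ^ i)) (ℤ.^-distribˡ-+-* g s i))
                                  (lemma (f (s ℕ.+ i)) (g ^ s) (g ^ i) (f i) (h ^ i))))
      (≈-trans (≈-* (≈-refl {x = g ^ s * (f i * f (s ℕ.+ i))}) (≈-trans (≈-reflexive (^-* i)) (≈-trans (≈-^ i gh≈1) (≈-reflexive (1^ i)))))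
               (≈-reflexive (ℤ.*-identityʳ _)))
      where
      lemma : ∀ x a b y c → x * (a * b) * (y * c) ≡ a * (y * x) * (b * c)
      lemma = solve-∀

    -- Starting the periodic sum `transform g` at index `i` makes `g ^ i` cancel against `h ^ i`,
    -- which leaves products of entries `s` apart.
    row : ∀ i → transform g * (f i * h ^ i) ≈ ∑ n (λ s → g ^ s * (f i * f (s ℕ.+ i))) [ q ]
    row i = ≈-trans (≈-* (≈-sym rotated) (≈-refl {x = f i * h ^ i}))
      (≈-trans (≈-reflexive (sym (∑-*ʳ n (f i * h ^ i) (λ s → f (s ℕ.+ i) * g ^ (s ℕ.+ i))))) (∑-≈ n (cancel i)))
      where
      rotated : ∑ n (λ s → f (s ℕ.+ i) * g ^ (s ℕ.+ i)) ≈ transform g [ q ]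
      rotated = ≈-trans (≈-reflexive (∑-cong n λ s → cong (λ j → f j * g ^ j) (ℕ.+-comm s i)))
                        (∑-rotate-≈ n i wrap)

    spectrum : ∀ k .{{_ : NonZero k}} → ∑ k (λ s → g ^ s * peak k w s) ≡ + w
    spectrum (suc k) = trans (cong₂ _+_ (ℤ.*-identityˡ (+ w)) (trans (∑-cong< k vanish) (∑-0 k))) (ℤ.+-identityʳ (+ w))
      where
      vanish : ∀ s → s < k → g ^ suc s * peak (suc k) w (suc s) ≡ 0ℤ
      vanish s s<k = trans (cong (g ^ suc s *_) zero-there) (ℤ.*-zeroʳ (g ^ suc s))
        where
        zero-there : peak (suc k) w (suc s) ≡ 0ℤ
        zero-there rewrite m<n⇒m%n≡m (s≤s s<k) = refl

  transform-unit : transform g * transform h ≈ + w [ q ]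
  transform-unit =
    ≈-trans (≈-reflexive (sym (∑-*ˡ n (transform g) (λ i → f i * h ^ i))))
    (≈-trans (∑-≈ n row)
    (≈-reflexive (trans (∑-swap n n (λ i s → g ^ s * (f i * f (s ℕ.+ i))))
      (trans (∑-cong n λ s → trans (∑-*ˡ n (g ^ s) (λ i → f i * f (s ℕ.+ i))) (cong (g ^ s *_) (correlation s))) (spectrum n)))))

-- Circulant matrices and finite sequences

Σ-toℕ : ∀ {n} {u : Vector ℤ n} {x : ℕ → ℤ} → (∀ i → u i ≡ x (toℕ i)) → Σ[ u ] ≡ ∑ n x
Σ-toℕ {zero}  eq = refl
Σ-toℕ {suc n} eq = cong₂ _+_ (eq zero) (Σ-toℕ (eq ∘ suc))

module _ {n} .{{_ : NonZero n}} where

  toℕ-mod : ∀ i → toℕ (i mod n) ≡ i % n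
  toℕ-mod i = toℕ-fromℕ< (m%n<n i n)

  mod-cong : ∀ {i j} → i % n ≡ j % n → i mod n ≡ j mod n
  mod-cong {i} {j} eq = toℕ-injective (trans (toℕ-mod i) (trans eq (sym (toℕ-mod j))))

  toℕ-mod-id : ∀ (i : Fin n) → toℕ i mod n ≡ i
  toℕ-mod-id i = toℕ-injective (trans (toℕ-mod (toℕ i)) (m<n⇒m%n≡m (toℕ<n i)))

  n+-% : ∀ i → (n ℕ.+ i) % n ≡ i % n
  n+-% i = trans (cong (_% n) (ℕ.+-comm n i)) ([m+n]%n≡m%n i n)

  mod-⊕ : ∀ i s → (i mod n) ⊕ s ≡ (i ℕ.+ s) mod n
  mod-⊕ i s = mod-cong {toℕ (i mod n) ℕ.+ s} {i ℕ.+ s} (trans (cong (λ k → (k ℕ.+ s) % n) (toℕ-mod i))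
    (trans (%-distribˡ-+ (i % n) s n)
    (trans (cong (λ k → (k ℕ.+ s % n) % n) (m%n%n≡m%n i n)) (sym (%-distribˡ-+ i s n)))))

  perfect : ∀ {w} (u : Vector ℤ n) → (∀ i → Ternary (u i)) →
            (∀ s → s < n → autocorrelation n (λ i → u (i mod n)) s ≡ peak n w s) →
            Perfect n w (λ i → u (i mod n))
  perfect {w} u tern corr = record
    { ternary     = λ i → tern (i mod n)
    ; periodic    = λ i → cong u (mod-cong {n ℕ.+ i} {i} (n+-% i))
    ; correlation = spread n _ corr λ s eq →
        trans (∑-cong n λ i → cong (λ j → u (i mod n) * u j)
                (mod-cong {n ℕ.+ s ℕ.+ i} {s ℕ.+ i} (trans (cong (_% n) (ℕ.+-assoc n s i)) (n+-% (s ℕ.+ i)))))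
        (trans eq (cong (λ r → if r ≡ᵇ 0 then + w else 0ℤ) (sym (n+-% s))))
    }

peak-0 : ∀ {n w} s → s < n → peak (suc n) w (suc s) ≡ 0ℤ
peak-0 s s<n rewrite m<n⇒m%n≡m (s≤s s<n) = refl

Σ-squares : ∀ {n} (u : Vector ℤ n) → (∀ i → Ternary (u i)) → Σ[ (λ i → u i * u i) ] ≡ + #nonzero u
Σ-squares {zero}  u tern = refl
Σ-squares {suc n} u tern with u zero | tern zero
... | _ | inj₁ refl        = trans (ℤ.+-identityˡ _) (Σ-squares (u ∘ suc) (tern ∘ suc))
... | _ | inj₂ (inj₁ refl) = cong (_+_ 1ℤ) (Σ-squares (u ∘ suc) (tern ∘ suc))
... | _ | inj₂ (inj₂ refl) = cong (_+_ 1ℤ) (Σ-squares (u ∘ suc) (tern ∘ suc))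

sequence⇒perfect : ∀ {n w} {u : Vector ℤ (suc n)} → IsPerfectTernary w u → Perfect (suc n) w (λ i → u (i mod suc n))
sequence⇒perfect {n} {w} {u} U = perfect u ternary corr
  where
  open IsPerfectTernary U renaming (autocorrelation to off-peak)
  f : ℕ → ℤ
  f i = u (i mod suc n)
  corr : ∀ s → s < suc n → autocorrelation (suc n) f s ≡ peak (suc n) w s
  corr zero _ = trans (sym (Σ-toℕ {x = λ i → f i * f i} λ i → sym (cong₂ _*_ (cong u (toℕ-mod-id i)) (cong u (toℕ-mod-id i)))))
    (trans (Σ-squares u ternary) (cong +_ weight))
  corr (suc s) (s≤s s<n) = trans (sym (Σ-toℕ {x = λ i → f i * f (suc s ℕ.+ i)} λ i → sym (cong₂ _*_ (cong u (toℕ-mod-id i))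
      (cong (λ k → u (k mod suc n)) (ℕ.+-comm (suc s) (toℕ i))))))
    (trans (off-peak (suc s) (s≤s z≤n) (s≤s s<n)) (sym (peak-0 s s<n)))

circulant⇒perfect : ∀ {n w} {W : Matrix (suc n)} → IsCirculantWeighing w W →
                    Perfect (suc n) w (λ i → W zero (i mod suc n))
circulant⇒perfect {n} {w} {W} (weighing , circulant) = perfect (W zero) (ternary zero) corr
  where
  open IsWeighing weighing
  f : ℕ → ℤ
  f i = W zero (i mod suc n)

  row : ∀ k (k<n : k < suc n) j → W (fromℕ< k<n) ((k ℕ.+ j) mod suc n) ≡ f j
  row zero    (s≤s z≤n)       j = refl
  row (suc k) k<n@(s≤s k<n′)  j = begin
    W (fromℕ< k<n) ((suc k ℕ.+ j) mod suc n)
      ≡⟨ cong (W (fromℕ< k<n)) (trans (mod-⊕ (k ℕ.+ j) 1) (cong (_mod suc n) (ℕ.+-comm (k ℕ.+ j) 1))) ⟨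
    W (fromℕ< k<n) (((k ℕ.+ j) mod suc n) ⊕ 1)
      ≡⟨ circulant (fromℕ< k<) (fromℕ< k<n) (trans (toℕ-fromℕ< k<n) (cong suc (sym (toℕ-fromℕ< k<)))) _ ⟩
    W (fromℕ< k<) ((k ℕ.+ j) mod suc n)
      ≡⟨ row k k< j ⟩
    f j ∎
    where
    open ≡-Reasoning
    k< : k < suc n
    k< = ℕ.m<n⇒m<1+n k<n′

  -- By `row`, f k is the entry of row s in column s + k, so after rotating the summation index by
  -- `s` the autocorrelation is the inner product of rows 0 and s.
  product : ∀ s (s<n : s < suc n) → autocorrelation (suc n) f s ≡ (W ⊗ W ᵀ) zero (fromℕ< s<n)
  product s s<n = begin
    ∑ (suc n) (λ k → f k * f (s ℕ.+ k))
      ≡⟨ ∑-cong (suc n) (λ k → trans (cong (_* f (s ℕ.+ k)) (sym (row s s<n k)))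
          (ℤ.*-comm (W (fromℕ< s<n) ((s ℕ.+ k) mod suc n)) (f (s ℕ.+ k)))) ⟩
    ∑ (suc n) (λ k → x (s ℕ.+ k))
      ≡⟨ ∑-rotate (suc n) s {x} (λ k → cong (λ j → W zero j * W (fromℕ< s<n) j) (mod-cong {i = suc n ℕ.+ k} {j = k} (n+-% k))) ⟩
    ∑ (suc n) x
      ≡⟨ Σ-toℕ {x = x} (λ k → sym (cong (λ j → W zero j * W (fromℕ< s<n) j) (toℕ-mod-id k))) ⟨
    (W ⊗ W ᵀ) zero (fromℕ< s<n) ∎
    where
    open ≡-Reasoning
    x : ℕ → ℤ
    x k = f k * W (fromℕ< s<n) (k mod suc n)

  corr : ∀ s → s < suc n → autocorrelation (suc n) f s ≡ peak (suc n) w s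
  corr zero    s<n@(s≤s z≤n) = trans (product 0 s<n) (trans (WWᵀ≡wI zero zero) (ℤ.*-identityʳ (+ w)))
  corr (suc s) s<n@(s≤s s<n′) = trans (product (suc s) s<n)
    (trans (WWᵀ≡wI zero (fromℕ< s<n)) (trans (ℤ.*-zeroʳ (+ w)) (sym (peak-0 s s<n′))))

-- The fold modulo 10

tern : List ℤ
tern = 0ℤ ∷ 1ℤ ∷ -1ℤ ∷ []

tern-∈ : ∀ {x} → Ternary x → x ∈ tern
tern-∈ (inj₁ refl)        = here refl
tern-∈ (inj₂ (inj₁ refl)) = there (here refl)
tern-∈ (inj₂ (inj₂ refl)) = there (there (here refl))

column : (ℕ → ℤ) → ℕ → List ℤ
column f p = applyUpTo (λ k → f (k ℕ.* 10 ℕ.+ p)) 6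

twist : ℤ → List ℤ → ℤ
twist σ = dot (applyUpTo (σ ^_) 6)

columns-∈ : ∀ {f} → (∀ i → Ternary (f i)) → ∀ p → Pointwise _∈_ (column f p) (replicate 6 tern)
columns-∈ {f} t p = go 6 λ k → f (k ℕ.* 10 ℕ.+ p) , t _
  where
  go : ∀ n (x : ℕ → ∃ Ternary) → Pointwise _∈_ (applyUpTo (proj₁ ∘ x) n) (replicate n tern)
  go zero    x = []
  go (suc n) x = tern-∈ (proj₂ (x 0)) ∷ go n (x ∘ suc)

column-check : ∀ {f} → (∀ i → Ternary (f i)) → (k : List ℤ → Bool) → boxes (replicate 6 tern) k ≡ true →
               ∀ p → k (column f p) ≡ true
column-check t k eq p = boxes-sound k eq (columns-∈ t p)

half : ℤ → ℤ
half (+ n)    = + ⌊ n /2⌋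
half -[1+ n ] = - + ⌊ suc n /2⌋

-- Chinese remaindering for x¹⁰ - 1 = (x⁵ - 1)(x⁵ + 1): the cyclic fold `es` and the negacyclic fold
-- `fs` modulo 5 determine the fold modulo 10.
halves : List ℤ → List ℤ → List ℤ
halves es fs = zipWith (λ e f → half (e + f)) es fs ++ zipWith (λ e f → half (e - f)) es fs

-- The residues modulo 4 that are congruent to b modulo 2.
lifts : ℤ → List ℤ
lifts b = b ∷ b + + 2 ∷ []

spike : List ℤ → Bool
spike []       = false
spike (b ∷ bs) = (∣ b ∣ ≡ᵇ 6) ∨ spike bs

-- The alternating fold modulo 10 agrees with the plain one modulo 2, and its negacyclic
-- autocorrelations vanish. If no lift of `bs` to residues modulo 4 has this property modulo 4, then
-- `bs` is not the fold of a perfect sequence.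
unliftable : List ℤ → Bool
unliftable bs = boxes (map lifts bs) λ ns → not (flat (divides 4) -1ℤ 9 ns)

-- Two shifts suffice for vectors of length 5, since shifts s and 5 - s have the same
-- autocorrelation up to sign.
alternating-test : List ℤ → List ℤ → Bool
alternating-test es fs = flat isZero -1ℤ 2 fs ⇒ spike (halves es fs) ∨ unliftable (halves es fs)

cyclic-test : List ℤ → Bool
cyclic-test es = flat isZero 1ℤ 2 es ⇒ sphere 6 5 36 (alternating-test es)

abstract
  cyclic-test-true : sphere 6 5 36 cyclic-test ≡ true
  cyclic-test-true = refl

half-double : ∀ b → half (b + b) ≡ b
half-double (+ n)    = cong +_ (sym (ℕ.n≡⌊n+n/2⌋ n))
half-double -[1+ n ] = cong -[1+_] (sym (ℕ.n≡⌊n+n/2⌋ n))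

spike-sound : ∀ n x → spike (applyUpTo x n) ≡ true → ∃ λ t → ∣ x t ∣ ≡ 6
spike-sound (suc n) x eq with ∨-elim (∣ x 0 ∣ ≡ᵇ 6) eq
... | inj₁ eq′ = 0 , ≡ᵇ-sound _ _ eq′
... | inj₂ eq′ = let t , p = spike-sound n (x ∘ suc) eq′ in suc t , p

constant : List ℤ → Bool
constant t = (∣ twist 1ℤ t ∣ ≡ᵇ 6) ⇒ equal t (replicate 6 1ℤ) ∨ equal t (replicate 6 -1ℤ)

constant-sound : ∀ t → constant t ≡ true → ∣ twist 1ℤ t ∣ ≡ 6 → t ≡ replicate 6 1ℤ ⊎ t ≡ replicate 6 -1ℤ
constant-sound t eq six with ∨-elim (equal t (replicate 6 1ℤ)) (⇒-elim eq (≡ᵇ-true six))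
... | inj₁ eq = inj₁ (equal-sound _ _ eq)
... | inj₂ eq = inj₂ (equal-sound _ _ eq)

record Normal (f : ℕ → ℤ) : Set where
  field
    isPerfect : Perfect 60 36 f
    ones      : column f 0 ≡ replicate 6 1ℤ
  open Perfect isPerfect public

abstract
  lift-parity : ∀ {x b} → x ≈ b [ 2 ] → ∃ λ v → v ∈ lifts b × v ≈ x [ 4 ]
  lift-parity {x} {b} (k , refl) with k %ℕ 2 | k /ℕ 2 | a≡a%ℕn+[a/ℕn]*n k 2 | n%ℕd<d k 2
  ... | 0 | l | refl | _ = b , here refl , (- l , lemma b l)
    where lemma : ∀ b l → b ≡ b + (0ℤ + l * + 2) * + 2 + - l * + 4
          lemma = solve-∀
  ... | 1 | l | refl | _ = b + + 2 , there (here refl) , (- l , lemma b l)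
    where lemma : ∀ b l → b + + 2 ≡ b + (1ℤ + l * + 2) * + 2 + - l * + 4
          lemma = solve-∀
  ... | suc (suc _) | _ | _ | s≤s (s≤s ())

  lift-parities : ∀ n {x b} → (∀ j → x j ≈ b j [ 2 ]) →
                  ∃ λ vs → Pointwise _∈_ vs (map lifts (applyUpTo b n)) × Approx 4 vs x n
  lift-parities zero    eq = [] , [] , []
  lift-parities (suc n) eq =
    let v , v∈ , v≈ = lift-parity (eq 0)
        vs , vs∈ , vs≈ = lift-parities n (eq ∘ suc)
    in v ∷ vs , v∈ ∷ vs∈ , v≈ ∷ vs≈

unliftable-sound : ∀ n {x b} → (∀ j → x j ≈ b j [ 2 ]) → unliftable (applyUpTo b n) ≡ true →
               (∀ {vs} → Approx 4 vs x n → flat (divides 4) -1ℤ 9 vs ≡ true) → ⊥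
unliftable-sound n x≈b eq is-flat =
  let vs , vs∈ , vs≈ = lift-parities n x≈b
  in not-true {flat (divides 4) -1ℤ 9 vs} (boxes-sound (λ ns → not (flat (divides 4) -1ℤ 9 ns)) eq vs∈) (is-flat vs≈)

spike-or-unliftable : ∀ {x y b} →
  norm 5 x ≡ 36 → flat isZero 1ℤ 2 (applyUpTo x 5) ≡ true →
  norm 5 y ≡ 36 → flat isZero -1ℤ 2 (applyUpTo y 5) ≡ true →
  (halves≡b : halves (applyUpTo x 5) (applyUpTo y 5) ≡ applyUpTo b 10) → (unliftable (applyUpTo b 10) ≡ true → ⊥) →
  ∃ λ t → ∣ b t ∣ ≡ 6
spike-or-unliftable {x} {y} {b} x-norm x-flat y-norm y-flat halves≡b liftable = conclude outcome halves≡b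
  where
  cyclic : cyclic-test (applyUpTo x 5) ≡ true
  -- 36 < 49 = 37 + 12, so the entries are at most 6 in absolute value.
  cyclic = sphere-sound 6 5 36 cyclic-test cyclic-test-true (ℕ.m≤m+n 37 12) x x-norm
  negacyclic : alternating-test (applyUpTo x 5) (applyUpTo y 5) ≡ true
  negacyclic = sphere-sound 6 5 36 (alternating-test (applyUpTo x 5))
    (⇒-elim {flat isZero 1ℤ 2 (applyUpTo x 5)} cyclic x-flat) (ℕ.m≤m+n 37 12) y y-norm
  outcome : spike (halves (applyUpTo x 5) (applyUpTo y 5)) ∨ unliftable (halves (applyUpTo x 5) (applyUpTo y 5)) ≡ true
  outcome = ⇒-elim {flat isZero -1ℤ 2 (applyUpTo y 5)} negacyclic y-flat
  conclude : ∀ {bs} → spike bs ∨ unliftable bs ≡ true → bs ≡ applyUpTo b 10 → ∃ λ t → ∣ b t ∣ ≡ 6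
  conclude {bs} eq bs≡ = [ (λ eq′ → spike-sound 10 b (subst (λ bs → spike bs ≡ true) bs≡ eq′))
                         , (λ eq′ → ⊥-elim (liftable (subst (λ bs → unliftable bs ≡ true) bs≡ eq′))) ]′ (∨-elim (spike bs) eq)

module _ {f} (P : Perfect 60 36 f) where

  open Perfect P

  private
    E F B N : ℕ → ℤ
    E = fold 12 5 1ℤ f
    F = fold 12 5 -1ℤ f
    B = fold 6 10 1ℤ f
    N = fold 6 10 -1ℤ f

    E+F : ∀ j → E j + F j ≡ B j + B j
    E+F j = lemma (f j) (f (5 ℕ.+ j)) (f (10 ℕ.+ j)) (f (15 ℕ.+ j)) (f (20 ℕ.+ j)) (f (25 ℕ.+ j))
                  (f (30 ℕ.+ j)) (f (35 ℕ.+ j)) (f (40 ℕ.+ j)) (f (45 ℕ.+ j)) (f (50 ℕ.+ j)) (f (55 ℕ.+ j))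
      where
      lemma : ∀ a b c d e f g h i j k l →
        (1ℤ * a + (1ℤ * b + (1ℤ * c + (1ℤ * d + (1ℤ * e + (1ℤ * f + (1ℤ * g + (1ℤ * h + (1ℤ * i + (1ℤ * j + (1ℤ * k + (1ℤ * l + 0ℤ))))))))))))
        + (1ℤ * a + (-1ℤ * b + (1ℤ * c + (-1ℤ * d + (1ℤ * e + (-1ℤ * f + (1ℤ * g + (-1ℤ * h + (1ℤ * i + (-1ℤ * j + (1ℤ * k + (-1ℤ * l + 0ℤ))))))))))))
        ≡ (1ℤ * a + (1ℤ * c + (1ℤ * e + (1ℤ * g + (1ℤ * i + (1ℤ * k + 0ℤ))))))
          + (1ℤ * a + (1ℤ * c + (1ℤ * e + (1ℤ * g + (1ℤ * i + (1ℤ * k + 0ℤ))))))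
      lemma = solve-∀

    E-F : ∀ j → E j - F j ≡ B (5 ℕ.+ j) + B (5 ℕ.+ j)
    E-F j = lemma (f j) (f (5 ℕ.+ j)) (f (10 ℕ.+ j)) (f (15 ℕ.+ j)) (f (20 ℕ.+ j)) (f (25 ℕ.+ j))
                  (f (30 ℕ.+ j)) (f (35 ℕ.+ j)) (f (40 ℕ.+ j)) (f (45 ℕ.+ j)) (f (50 ℕ.+ j)) (f (55 ℕ.+ j))
      where
      lemma : ∀ a b c d e f g h i j k l →
        (1ℤ * a + (1ℤ * b + (1ℤ * c + (1ℤ * d + (1ℤ * e + (1ℤ * f + (1ℤ * g + (1ℤ * h + (1ℤ * i + (1ℤ * j + (1ℤ * k + (1ℤ * l + 0ℤ))))))))))))
        - (1ℤ * a + (-1ℤ * b + (1ℤ * c + (-1ℤ * d + (1ℤ * e + (-1ℤ * f + (1ℤ * g + (-1ℤ * h + (1ℤ * i + (-1ℤ * j + (1ℤ * k + (-1ℤ * l + 0ℤ))))))))))))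
        ≡ (1ℤ * b + (1ℤ * d + (1ℤ * f + (1ℤ * h + (1ℤ * j + (1ℤ * l + 0ℤ))))))
          + (1ℤ * b + (1ℤ * d + (1ℤ * f + (1ℤ * h + (1ℤ * j + (1ℤ * l + 0ℤ))))))
      lemma = solve-∀

    N≈B : ∀ j → N j ≈ B j [ 2 ]
    -- The folds differ in the sign of the terms with odd `k`, hence by twice the sum of these.
    N≈B j = - (f (10 ℕ.+ j) + f (30 ℕ.+ j) + f (50 ℕ.+ j)) , lemma (f j) (f (10 ℕ.+ j)) (f (20 ℕ.+ j)) (f (30 ℕ.+ j)) (f (40 ℕ.+ j)) (f (50 ℕ.+ j))
      where
      lemma : ∀ a b c d e f →
        1ℤ * a + (-1ℤ * b + (1ℤ * c + (-1ℤ * d + (1ℤ * e + (-1ℤ * f + 0ℤ)))))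
        ≡ 1ℤ * a + (1ℤ * b + (1ℤ * c + (1ℤ * d + (1ℤ * e + (1ℤ * f + 0ℤ))))) + - (b + d + f) * + 2
      lemma = solve-∀

    halves≡B : halves (applyUpTo E 5) (applyUpTo F 5) ≡ applyUpTo B 10
    halves≡B = cong₂ _++_
      (applyUpTo-cong< 5 {λ j → half (E j + F j)} {B} λ j _ → trans (cong half (E+F j)) (half-double (B j)))
      (applyUpTo-cong< 5 {λ j → half (E j - F j)} {λ j → B (5 ℕ.+ j)} λ j _ → trans (cong half (E-F j)) (half-double (B (5 ℕ.+ j))))

    liftable : unliftable (applyUpTo B 10) ≡ true → ⊥
    liftable eq = unliftable-sound 10 {N} {B} N≈B eq
      (Fold.F-flat P 6 10 refl -1ℤ refl refl (divides 4) (divides-true 4) 9 refl)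

    spiked : ∃ λ t → ∣ B t ∣ ≡ 6
    spiked = spike-or-unliftable {E} {F} {B}
      (Fold.F-norm P 12 5 refl 1ℤ refl refl 36 refl) (Fold.F-flat P 12 5 refl 1ℤ refl refl isZero isZero-true 2 refl (exact E 5))
      (Fold.F-norm P 12 5 refl -1ℤ refl refl 36 refl) (Fold.F-flat P 12 5 refl -1ℤ refl refl isZero isZero-true 2 refl (exact F 5))
      halves≡B liftable

    constant-column : ∀ t → column f t ≡ replicate 6 1ℤ ⊎ column f t ≡ replicate 6 -1ℤ → ∃ Normal
    constant-column t = λ
      { (inj₁ eq) → _ , record { isPerfect = translate t P ; ones = trans moved eq }
      ; (inj₂ eq) → _ , record { isPerfect = negate (translate t P) ; ones = cong (map (λ x → - x)) (trans moved eq) }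
      }
      where
      moved : column (λ i → f (t ℕ.+ i)) 0 ≡ column f t
      moved = applyUpTo-cong< 6 λ k _ → cong f (trans (cong (t ℕ.+_) (ℕ.+-identityʳ _)) (ℕ.+-comm t (k ℕ.* 10)))

  normalise : ∃ Normal
  normalise = let t , eq = spiked in
    constant-column t (constant-sound (column f t) (column-check {f} ternary constant refl t) eq)

-- Slopes modulo 3

-- Since 9 ≡ -1 modulo 10, v(x⁻¹) = v(x)⁹ in F₃[C₁₀]; vanishing autocorrelations, shift 0 included,
-- thus mean v¹⁰ = 0, and the ring is reduced because 3 does not divide 10. The check itself is a
-- search.
anisotropic : List ℤ → Bool
anisotropic vs = flatFrom (divides 3) 1ℤ vs vs 10 ⇒ all isZero vs

abstract
  anisotropic-true : boxes (replicate 10 tern) anisotropic ≡ true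
  anisotropic-true = refl

norm-0 : ∀ n x → norm n x ≡ 0 → ∀ i → i < n → x i ≡ 0ℤ
norm-0 (suc n) x eq zero    _         = ℤ.∣i∣≡0⇒i≡0 (square-0 (ℕ.m+n≡0⇒m≡0 (∣ x 0 ∣ ℕ.* ∣ x 0 ∣) eq))
  where
  square-0 : ∀ {k} → k ℕ.* k ≡ 0 → k ≡ 0
  square-0 {zero} _ = refl
norm-0 (suc n) x eq (suc i) (s≤s i<n) = norm-0 n (x ∘ suc) (ℕ.m+n≡0⇒n≡0 (∣ x 0 ∣ ℕ.* ∣ x 0 ∣) eq) i i<n

norm-double : ∀ n {x y} → (∀ i → i < n → y i ≡ x i + x i) → norm n y ≡ 4 ℕ.* norm n x
norm-double zero            eq = refl
norm-double (suc n) {x} {y} eq = trans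
  (cong₂ ℕ._+_ (trans (cong (λ v → ∣ v ∣ ℕ.* ∣ v ∣) (eq 0 (s≤s z≤n))) (double (x 0)))
               (norm-double n λ i i<n → eq (suc i) (s≤s i<n)))
  (sym (ℕ.*-distribˡ-+ 4 (∣ x 0 ∣ ℕ.* ∣ x 0 ∣) (norm n (x ∘ suc))))
  where
  lemma : ∀ k → (2 ℕ.* k) ℕ.* (2 ℕ.* k) ≡ 4 ℕ.* (k ℕ.* k)
  lemma = ℕSolver.solve-∀
  twice : ∀ v → v + v ≡ + 2 * v
  twice = solve-∀
  double : ∀ v → ∣ v + v ∣ ℕ.* ∣ v + v ∣ ≡ 4 ℕ.* (∣ v ∣ ℕ.* ∣ v ∣)
  double v = trans (cong (λ k → k ℕ.* k) (trans (cong ∣_∣ (twice v)) (ℤ.abs-* (+ 2) v))) (lemma ∣ v ∣)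

peak-≈ : ∀ {n w} .{{_ : NonZero n}} {q} s → + w ≈ 0ℤ [ q ] → peak n w s ≈ 0ℤ [ q ]
peak-≈ {n} s w≈0 with (s Data.Nat.DivMod.% n) ≡ᵇ 0
... | true  = w≈0
... | false = ≈-refl

abstract
  residue₃ : ∀ x → ∃ λ v → v ∈ tern × v ≈ x [ 3 ]
  residue₃ x with x %ℕ 3 | x /ℕ 3 | a≡a%ℕn+[a/ℕn]*n x 3 | n%ℕd<d x 3
  ... | 0 | l | refl | _ = 0ℤ , here refl , ≈-sym (l , refl)
  ... | 1 | l | refl | _ = 1ℤ , there (here refl) , ≈-sym (l , refl)
  ... | 2 | l | refl | _ = -1ℤ , there (there (here refl)) , ≈-sym (l + 1ℤ , lemma l)
    where lemma : ∀ l → + 2 + l * + 3 ≡ -1ℤ + (l + 1ℤ) * + 3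
          lemma = solve-∀
  ... | suc (suc (suc _)) | _ | _ | s≤s (s≤s (s≤s ()))

  residues₃ : ∀ n x → ∃ λ vs → Pointwise _∈_ vs (replicate n tern) × Approx 3 vs x n
  residues₃ zero    x = [] , [] , []
  residues₃ (suc n) x =
    let v , v∈ , v≈ = residue₃ (x 0)
        vs , vs∈ , vs≈ = residues₃ n (x ∘ suc)
    in v ∷ vs , v∈ ∷ vs∈ , v≈ ∷ vs≈

vanishes : ∀ {m vs x n} → Approx m vs x n → all isZero vs ≡ true → ∀ i → i < n → x i ≈ 0ℤ [ m ]
vanishes {vs = v ∷ _} (p ∷ ps) eq zero    _         = ≈-trans (≈-sym p) (≈-reflexive (isZero-sound v (∧-conicalˡ _ _ eq)))
vanishes {vs = v ∷ _} (p ∷ ps) eq (suc i) (s≤s i<n) = vanishes ps (∧-conicalʳ (isZero v) _ eq) i i<n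

-- Modulo 3, the three-term progressions x j, x (10 + j), x (20 + j) of sum 0 have a slope,
-- and the autocorrelation of x is minus that of the slopes.
module Slopes {x : ℕ → ℤ} (triple : ∀ j → x j + x (10 ℕ.+ j) + x (20 ℕ.+ j) ≈ 0ℤ [ 3 ])
              (corr : ∀ s → autocorrelation 30 x s ≈ 0ℤ [ 3 ]) where

  slope : ℕ → ℤ
  slope j = x (10 ℕ.+ j) - x j

  private
    -- For progressions a, a + d, a + 2d and a′, a′ + d′, a′ + 2d′ the sum of products is 3aa′ +
    -- 3ad′ + 3a′d + 5dd′, congruent to -dd′. The quotient results from eliminating c and c′.
    products : ∀ a b c a′ b′ c′ → a + b + c ≈ 0ℤ [ 3 ] → a′ + b′ + c′ ≈ 0ℤ [ 3 ] →
               (b - a) * (b′ - a′) ≈ -1ℤ * (a * a′ + (b * b′ + (c * c′ + 0ℤ))) [ 3 ]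
    products a b c a′ b′ c′ (k , eq) (k′ , eq′) =
      (a * a′ + b * b′ + + 3 * k * k′ - k * (a′ + b′) - k′ * (a + b)) ,
      (subst₂ (λ c c′ → (b - a) * (b′ - a′) ≡ -1ℤ * (a * a′ + (b * b′ + (c * c′ + 0ℤ)))
                 + (a * a′ + b * b′ + + 3 * k * k′ - k * (a′ + b′) - k′ * (a + b)) * + 3)
        (sym (isolate a b c k eq)) (sym (isolate a′ b′ c′ k′ eq′)) (lemma a b a′ b′ k k′))
      where
      isolate : ∀ a b c k → a + b + c ≡ 0ℤ + k * + 3 → c ≡ k * + 3 - a - b
      isolate a b c k eq = trans (lemma₁ a b c) (trans (cong (λ z → z - a - b) eq) (lemma₂ a b k))
        where
        lemma₁ : ∀ a b c → c ≡ a + b + c - a - b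
        lemma₁ = solve-∀
        lemma₂ : ∀ a b k → 0ℤ + k * + 3 - a - b ≡ k * + 3 - a - b
        lemma₂ = solve-∀
      lemma : ∀ a b a′ b′ k k′ → (b - a) * (b′ - a′)
        ≡ -1ℤ * (a * a′ + (b * b′ + ((k * + 3 - a - b) * (k′ * + 3 - a′ - b′) + 0ℤ)))
          + (a * a′ + b * b′ + + 3 * k * k′ - k * (a′ + b′) - k′ * (a + b)) * + 3
      lemma = solve-∀

    slope-corr : ∀ s → autocorrelation 10 slope s ≈ 0ℤ [ 3 ]
    slope-corr s =
      ≈-trans (∑-≈ 10 {λ j → slope j * slope (s ℕ.+ j)} {λ j → -1ℤ * ∑ 3 (λ k → h (k ℕ.* 10 ℕ.+ j))} local)
      (≈-trans (≈-reflexive (trans (∑-*ˡ 10 -1ℤ (λ j → ∑ 3 (λ k → h (k ℕ.* 10 ℕ.+ j))))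
                                   (cong (-1ℤ *_) (sym (∑-blocks 3 10 h)))))
      (≈-* (≈-refl {x = -1ℤ}) (corr s)))
      where
      h : ℕ → ℤ
      h i = x i * x (s ℕ.+ i)
      move : ∀ c j → x (s ℕ.+ (c ℕ.+ j)) ≡ x (c ℕ.+ (s ℕ.+ j))
      move c j = cong x (x∙yz≈y∙xz s c j)
      local : ∀ j → slope j * slope (s ℕ.+ j) ≈ -1ℤ * ∑ 3 (λ k → h (k ℕ.* 10 ℕ.+ j)) [ 3 ]
      local j = ≈-trans
        (products (x j) (x (10 ℕ.+ j)) (x (20 ℕ.+ j)) (x (s ℕ.+ j)) (x (10 ℕ.+ (s ℕ.+ j))) (x (20 ℕ.+ (s ℕ.+ j)))
                  (triple j) (triple (s ℕ.+ j)))
        (≈-reflexive (cong₂ (λ u v → -1ℤ * (x j * x (s ℕ.+ j) + (x (10 ℕ.+ j) * u + (x (20 ℕ.+ j) * v + 0ℤ))))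
          (sym (move 10 j)) (sym (move 20 j))))

    -- (c - b) - (b - a) = (a + b + c) - 3b, so modulo 3 a shift by 10 leaves the slope unchanged.
    slope-periodic : ∀ j → slope (10 ℕ.+ j) ≈ 1ℤ * slope j [ 3 ]
    slope-periodic j = ≈-trans (≈-reflexive (lemma (x j) (x (10 ℕ.+ j)) (x (20 ℕ.+ j))))
      (≈-trans (≈-+ (triple j) (≈-refl {x = 1ℤ * slope j - + 3 * x (10 ℕ.+ j)}))
      (- x (10 ℕ.+ j) , lemma′ (1ℤ * slope j) (x (10 ℕ.+ j))))
      where
      lemma : ∀ a b c → c - b ≡ a + b + c + (1ℤ * (b - a) - + 3 * b)
      lemma = solve-∀
      lemma′ : ∀ u b → 0ℤ + (u - + 3 * b) ≡ u + - b * + 3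
      lemma′ = solve-∀

  slope≈0 : ∀ j → j < 10 → slope j ≈ 0ℤ [ 3 ]
  slope≈0 =
    let vs , vs∈ , vs≈ = residues₃ 10 slope in
    vanishes vs≈ (⇒-elim {flatFrom (divides 3) 1ℤ vs vs 10} (boxes-sound anisotropic anisotropic-true vs∈)
      (flatFrom-true (divides 3) 1ℤ (divides-true 3) 10 vs≈ vs≈ slope-periodic (λ s _ → slope-corr s)))

-- The search over columns

prime : ℕ
prime = 100000081

power : ℕ → ℕ → ℕ
power g zero    = 1
power g (suc i) = (g ℕ.* power g i) % 100000081

digit : ℤ → ℕ → ℕ
digit (+ 0) c = 0
digit (+ _) c = c
digit _     c = prime ℕ.∸ c

digits : List ℕ → List ℤ → ℕ
digits (c ∷ cs) (a ∷ as) = digit a c ℕ.+ digits cs as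
digits _        _        = 0

evaluate : List ℕ → List ℤ → ℕ
evaluate cs as = digits cs as % 100000081

-- The three sums f j + f (30 + j) in a column: its part of the fold modulo 30.
pairs : List ℤ → List ℤ
pairs (a ∷ b ∷ c ∷ d ∷ e ∷ f ∷ []) = a + d ∷ b + e ∷ c + f ∷ []
pairs _                            = []

sumSq : List ℤ → ℕ
sumSq []       = 0
sumSq (a ∷ as) = ∣ a ∣ ℕ.* ∣ a ∣ ℕ.+ sumSq as

slopeOf : List ℤ → ℤ
slopeOf (a ∷ b ∷ _) = b - a
slopeOf _           = 0ℤ

-- The sums of cost, of the norm and of the squared alternating sum over all columns are known.
-- In this combination a column of cost 0 has the large weight 24, 72 or 96 unless it is constant
-- on its even and on its odd part, so that few columns fit in the total 192.
cost weight : List ℤ → ℕ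
cost t   = sumSq (pairs t)
weight t = 18 ℕ.* sumSq t ℕ.∸ (3 ℕ.* (∣ twist -1ℤ t ∣ ℕ.* ∣ twist -1ℤ t ∣) ℕ.+ 10 ℕ.* cost t)

-- What the search knows of a column: its cost and weight, and its contribution to the values
-- of f at three roots of unity, of orders 15, 30 and 60, and at their inverses.
record Mark : Set where
  constructor mark
  field
    n e e′ f f′ w x y : ℕ

powers : ℕ → ℕ → List ℕ
powers g p = applyUpTo (λ k → power g (k ℕ.* 10 ℕ.+ p)) 6

markWith : (a a′ b b′ c c′ : List ℕ) → List ℤ → Mark
markWith a a′ b b′ c c′ t =
  mark (cost t) (evaluate a t) (evaluate a′ t) (evaluate b t) (evaluate b′ t) (weight t) (evaluate c t) (evaluate c′ t)

-- 67157139 has order 60 modulo the prime. The six bases are its fourth power, its square and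
-- itself, each followed by its inverse.
markAt : ℕ → (List ℤ → Mark)
markAt p = markWith (powers 45715011 p) (powers 96853414 p) (powers 65502465 p) (powers 21918428 p)
                    (powers 67157139 p) (powers 23555555 p)

data Member : Set where
  member : (w x y : ℕ) → Member

-- Columns that differ only in w, x and y: the outer search chooses the groups, the inner search
-- their members.
data Group : Set where
  group : (n e e′ f f′ : ℕ) → List Member → Group

hitMember : List Member → ℕ → ℕ → ℕ → Bool
hitMember []                     w x y = false
hitMember (member w₁ x₁ y₁ ∷ ms) w x y = ((w₁ ≡ᵇ w) ∧ (x₁ ≡ᵇ x) ∧ (y₁ ≡ᵇ y)) ∨ hitMember ms w x y

addMember : List Member → ℕ → ℕ → ℕ → List Member
addMember ms w x y = if hitMember ms w x y then ms else member w x y ∷ ms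

insert : Mark → List Group → List Group
insert (mark n e e′ f f′ w x y) [] = group n e e′ f f′ (member w x y ∷ []) ∷ []
insert (mark n e e′ f f′ w x y) (group n₁ e₁ e₁′ f₁ f₁′ ms ∷ gs) =
  if (e₁ ≡ᵇ e) ∧ (e₁′ ≡ᵇ e′) ∧ (f₁ ≡ᵇ f) ∧ (f₁′ ≡ᵇ f′) ∧ (n₁ ≡ᵇ n)
  then group n₁ e₁ e₁′ f₁ f₁′ (addMember ms w x y) ∷ gs
  else group n₁ e₁ e₁′ f₁ f₁′ ms ∷ insert (mark n e e′ f f′ w x y) gs

hit : List Group → Mark → Bool
hit []                               _                          = false
hit (group n₁ e₁ e₁′ f₁ f₁′ ms ∷ gs) (mark n e e′ f f′ w x y) =
  ((n₁ ≡ᵇ n) ∧ (e₁ ≡ᵇ e) ∧ (e₁′ ≡ᵇ e′) ∧ (f₁ ≡ᵇ f) ∧ (f₁′ ≡ᵇ f′) ∧ hitMember ms w x y)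
  ∨ hit gs (mark n e e′ f f′ w x y)

-- 100000045 is -36 modulo the prime.
opaque
  unit : ℕ → ℕ → Bool
  unit x y = (x ℕ.* y ℕ.+ 100000045) % 100000081 ≡ᵇ 0

-- Weight must be spent exactly: a remainder closes a branch, as does a member heavier than what is
-- left. At a leaf the equation at the root of order 60 has to fail.
inner     : List (List Member) → (w x y : ℕ) → Bool
innerOver : List Member → List (List Member) → (w x y : ℕ) → Bool
inner []         zero    x y = not (unit x y)
inner []         (suc _) x y = true
inner (ms ∷ mss) w       x y = innerOver ms mss w x y
innerOver []                    mss w x y = true
innerOver (member v a b ∷ ms) mss w x y =
  (if v ≤ᵇ w then inner mss (w ℕ.∸ v) (x ℕ.+ a) (y ℕ.+ b) else true) ∧ innerOver ms mss w x y

-- The cost is spent in the same way. The inner search starts only where the equations at the roots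
-- of orders 15 and 30 hold.
outer     : ℕ → List (List Group) → (n e e′ f f′ : ℕ) → List (List Member) → Bool
outerOver : ℕ → List Group → List (List Group) → (n e e′ f f′ : ℕ) → List (List Member) → Bool
outer w []         zero    e e′ f f′ mss = if unit e e′ ∧ unit f f′ then inner mss w 0 0 else true
outer w []         (suc _) e e′ f f′ mss = true
outer w (gs ∷ gss) n       e e′ f f′ mss = outerOver w gs gss n e e′ f f′ mss
outerOver w []                              gss n e e′ f f′ mss = true
outerOver w (group k a a′ b b′ ms ∷ gs) gss n e e′ f f′ mss =
  (if k ≤ᵇ n then outer w gss (n ℕ.∸ k) (e ℕ.+ a) (e′ ℕ.+ a′) (f ℕ.+ b) (f′ ℕ.+ b′) (ms ∷ mss) else true)
  ∧ outerOver w gs gss n e e′ f f′ mss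

-- The columns before the first one of nonzero cost are flat, and that one can be assumed
-- canonical, since translating f by multiples of 10 rotates the columns.
data Kind : Set where
  flatK firstK anyK : Kind

-- A balanced column of nonzero cost has pair sums ±(1, 1, -2) in some order, hence cost 6. The 24
-- such columns form four orbits under rotation, represented here.
canonical : List ℤ → Bool
canonical t =
    equal t (-1ℤ ∷ 1ℤ ∷ 1ℤ ∷ -1ℤ ∷ 0ℤ ∷ 0ℤ ∷ [])
  ∨ equal t (1ℤ ∷ -1ℤ ∷ -1ℤ ∷ 1ℤ ∷ 0ℤ ∷ 0ℤ ∷ [])
  ∨ equal t (-1ℤ ∷ 0ℤ ∷ 1ℤ ∷ -1ℤ ∷ 1ℤ ∷ 0ℤ ∷ [])
  ∨ equal t (1ℤ ∷ -1ℤ ∷ 0ℤ ∷ 1ℤ ∷ 0ℤ ∷ -1ℤ ∷ [])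

balanced : List ℤ → Bool
balanced t = isZero (twist 1ℤ t) ∧ divides 3 (slopeOf (pairs t))

ofKind : Kind → List ℤ → Bool
ofKind flatK  t = cost t ≡ᵇ 0
ofKind firstK t = canonical t
ofKind anyK   t = true

-- A column with alternating sum ±6 contributes nothing at the three roots of unity, so it can be
-- treated like one with alternating sum 0.
ofMagnitude : ℤ → List ℤ → Bool
ofMagnitude m t = isZero (twist -1ℤ t - (m + m)) ∨ (isZero m ∧ (∣ twist -1ℤ t ∣ ≡ᵇ 6))

admissible : Kind → ℤ → List ℤ → Bool
admissible κ m t = ofKind κ t ∧ ofMagnitude m t

tuples : ℕ → List (List ℤ)
tuples zero    = [] ∷ []
tuples (suc n) = concatMap (λ v → map (v ∷_) (tuples n)) tern

groupsWith : (a a′ b b′ c c′ : List ℕ) → List (List ℤ) → List Group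
groupsWith a a′ b b′ c c′ ts = foldr insert [] (map (markWith a a′ b b′ c c′) ts)

groups : List (List ℤ) → Kind → ℤ → ℕ → List Group
groups ts κ m p =
  groupsWith (powers 45715011 p) (powers 96853414 p) (powers 65502465 p) (powers 21918428 p)
             (powers 67157139 p) (powers 23555555 p) (filterᵇ (admissible κ m) ts)

kindAt : ℕ → ℕ → Kind
kindAt i j = if j <ᵇ i then flatK else if j ≡ᵇ i then firstK else anyK

tables : List (List ℤ) → ℕ → List ℤ → List (List Group)
tables ts i ms = applyUpTo (λ j → groups ts (kindAt i j) (at ms j) (suc j)) 9

opaque
  refuted : List (List ℤ) → List ℤ → Bool
  -- `i` is the place of the first column of nonzero cost. The totals are 24 = 36 - 12 for the cost
  -- and 192 = 18 · 30 - 3 · 36 - 10 · 24 for the weight.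
  refuted ts ms = below 9 λ i → outer 192 (tables ts i ms) 24 0 0 0 0 []

candidates : List (List ℤ)
candidates = filterᵇ balanced (tuples 6)

-- Instead of a correctness proof for `insert`, each finished table is compared with all ternary
-- columns.
covers : Kind → ℤ → ℕ → List Group → List ℤ → Bool
covers κ m p gs t = balanced t ⇒ admissible κ m t ⇒ hit gs (markAt p t)

opaque
  complete : Kind → ℤ → ℕ → Bool
  complete κ m p = boxes (replicate 6 tern) (covers κ m p (groups candidates κ m p))

completeAt : ℕ → Bool
completeAt j = all (λ κ → all (λ m → complete κ m (suc j)) tern) (flatK ∷ firstK ∷ anyK ∷ [])

-- A flat vector of norm 9 has either a single nonzero entry ±3 or all entries ±1. By the convention
-- in `ofMagnitude` the first type is covered by the zero vector, refuted once in `refuted-0`; the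
-- second is refuted vector by vector.
magnitudes : List ℤ → Bool
magnitudes ms = all (λ m → isZero m ∨ (∣ m ∣ ≡ᵇ 3)) ms ∨ (all (λ m → ∣ m ∣ ≡ᵇ 1) ms ∧ refuted candidates ms)

spectral : List ℤ → Bool
spectral ms = flat isZero -1ℤ 9 (0ℤ ∷ map (λ m → m + m) ms) ⇒ magnitudes ms

opaque
  unfolding unit refuted complete

  complete-true : below 9 completeAt ≡ true
  complete-true = refl

  refuted-0 : refuted candidates (applyUpTo (λ _ → 0ℤ) 9) ≡ true
  refuted-0 = refl

  spectral-true : sphere 3 9 9 spectral ≡ true
  spectral-true = refl

-- Soundness of the search

total : (Mark → ℕ) → List Mark → ℕ
total h []       = 0
total h (c ∷ cs) = h c ℕ.+ total h cs

HitMember : List Member → Mark → Set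
HitMember ms c = hitMember ms (Mark.w c) (Mark.x c) (Mark.y c) ≡ true

Hit : List Group → Mark → Set
Hit gs c = hit gs c ≡ true

-- The branch of the actual columns is never pruned, as each cost or weight is one summand of what
-- is left.
prefix-≤ : ∀ {k a b n} → k ≡ a → a ℕ.+ b ≡ n → (k ≤ᵇ n) ≡ true
prefix-≤ {k} {b = b} refl refl = ≤⇒≤ᵇ≡true {k} (ℕ.m≤m+n k b)

suffix : ∀ {k a b n} → k ≡ a → a ℕ.+ b ≡ n → b ≡ n ℕ.∸ k
suffix {k} {b = b} refl refl = sym (ℕ.m+n∸m≡n k b)

inner-sound : ∀ mss cs w x y → inner mss w x y ≡ true → Pointwise HitMember mss cs → total Mark.w cs ≡ w →
              ¬ unit (x ℕ.+ total Mark.x cs) (y ℕ.+ total Mark.y cs) ≡ true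
innerOver-sound : ∀ ms mss c cs w x y → innerOver ms mss w x y ≡ true → HitMember ms c → Pointwise HitMember mss cs →
               Mark.w c ℕ.+ total Mark.w cs ≡ w → ¬ unit (x ℕ.+ (Mark.x c ℕ.+ total Mark.x cs)) (y ℕ.+ (Mark.y c ℕ.+ total Mark.y cs)) ≡ true
inner-sound [] [] .0 x y eq [] refl is-unit =
  not-true {unit x y} eq (subst₂ (λ x y → unit x y ≡ true) (ℕ.+-identityʳ x) (ℕ.+-identityʳ y) is-unit)
inner-sound (ms ∷ mss) (c ∷ cs) w x y eq (h ∷ hs) sum is-unit =
  innerOver-sound ms mss c cs w x y eq h hs sum is-unit
innerOver-sound (member w₁ x₁ y₁ ∷ ms) mss c cs w x y eq h hs sum is-unit =
  [ found , (λ h′ → innerOver-sound ms mss c cs w x y rest h′ hs sum is-unit) ]′ (∨-elim _ h)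
  where
  first = ∧-conicalˡ (if w₁ ≤ᵇ w then inner mss (w ℕ.∸ w₁) (x ℕ.+ x₁) (y ℕ.+ y₁) else true) _ eq
  rest  = ∧-conicalʳ (if w₁ ≤ᵇ w then inner mss (w ℕ.∸ w₁) (x ℕ.+ x₁) (y ℕ.+ y₁) else true) _ eq
  found : ((w₁ ≡ᵇ Mark.w c) ∧ (x₁ ≡ᵇ Mark.x c) ∧ (y₁ ≡ᵇ Mark.y c)) ≡ true → ⊥
  found eqs =
    let w≡ , eqs = ∧-elim (w₁ ≡ᵇ Mark.w c) eqs
        x≡ , y≡  = ∧-elim (x₁ ≡ᵇ Mark.x c) eqs
        w₁≡ = ≡ᵇ-sound w₁ (Mark.w c) w≡
    in inner-sound mss cs (w ℕ.∸ w₁) (x ℕ.+ x₁) (y ℕ.+ y₁)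
         (⇒-elim {w₁ ≤ᵇ w} {inner mss (w ℕ.∸ w₁) (x ℕ.+ x₁) (y ℕ.+ y₁)} first (prefix-≤ w₁≡ sum))
         hs (suffix w₁≡ sum)
         (subst₂ (λ x y → unit x y ≡ true)
           (trans (cong (λ k → x ℕ.+ (k ℕ.+ total Mark.x cs)) (sym (≡ᵇ-sound x₁ (Mark.x c) x≡))) (sym (ℕ.+-assoc x x₁ _)))
           (trans (cong (λ k → y ℕ.+ (k ℕ.+ total Mark.y cs)) (sym (≡ᵇ-sound y₁ (Mark.y c) y≡))) (sym (ℕ.+-assoc y y₁ _)))
           is-unit)

module _ (w : ℕ) where

  -- The invariant along the branch of the actual columns: `ds` are chosen, `cs` outstanding, `n` is
  -- the cost left, and `e` to `f′` are accumulated sums. Weight and the values at the root of order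
  -- 60 are left to the inner search, so they are stated for `ds` and `cs` together.
  record Outcome (cs ds : List Mark) (n e e′ f f′ : ℕ) : Set where
    field
      n-total : total Mark.n cs ≡ n
      e-unit  : unit (e ℕ.+ total Mark.e cs) (e′ ℕ.+ total Mark.e′ cs) ≡ true
      f-unit  : unit (f ℕ.+ total Mark.f cs) (f′ ℕ.+ total Mark.f′ cs) ≡ true
      w-total : total Mark.w ds ℕ.+ total Mark.w cs ≡ w
      x-unit  : unit (total Mark.x ds ℕ.+ total Mark.x cs) (total Mark.y ds ℕ.+ total Mark.y cs) ≡ true

  private
    shift-unit : ∀ {a b c a′ b′ c′ d d′} → c ≡ b → c′ ≡ b′ → unit (a ℕ.+ (b ℕ.+ d)) (a′ ℕ.+ (b′ ℕ.+ d′)) ≡ true →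
                 unit (a ℕ.+ c ℕ.+ d) (a′ ℕ.+ c′ ℕ.+ d′) ≡ true
    shift-unit {a} {b} {a′ = a′} {b′} {d = d} {d′} refl refl =
      subst₂ (λ x y → unit x y ≡ true) (sym (ℕ.+-assoc a b d)) (sym (ℕ.+-assoc a′ b′ d′))

    exchange : ∀ a b c → a ℕ.+ (b ℕ.+ c) ≡ (b ℕ.+ a) ℕ.+ c
    exchange a b c = trans (sym (ℕ.+-assoc a b c)) (cong (ℕ._+ c) (ℕ.+-comm a b))

  outer-sound : ∀ gss cs n e e′ f f′ mss ds → outer w gss n e e′ f f′ mss ≡ true →
                Pointwise Hit gss cs → Pointwise HitMember mss ds → ¬ Outcome cs ds n e e′ f f′
  outerOver-sound : ∀ gs gss c cs n e e′ f f′ mss ds → outerOver w gs gss n e e′ f f′ mss ≡ true →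
                 Hit gs c → Pointwise Hit gss cs → Pointwise HitMember mss ds → ¬ Outcome (c ∷ cs) ds n e e′ f f′
  outer-sound [] [] zero e e′ f f′ mss ds eq [] hs O =
    inner-sound mss ds w 0 0 (⇒-elim {unit e e′ ∧ unit f f′} {inner mss w 0 0} eq (cong₂ _∧_ (strip e-unit) (strip f-unit))) hs
      (trans (sym (ℕ.+-identityʳ (total Mark.w ds))) w-total) (strip x-unit)
    where
    open Outcome O
    strip : ∀ {x y} → unit (x ℕ.+ 0) (y ℕ.+ 0) ≡ true → unit x y ≡ true
    strip {x} {y} = subst₂ (λ x y → unit x y ≡ true) (ℕ.+-identityʳ x) (ℕ.+-identityʳ y)
  outer-sound [] [] (suc n) e e′ f f′ mss ds eq [] hs O with () ← Outcome.n-total O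
  outer-sound (gs ∷ gss) (c ∷ cs) n e e′ f f′ mss ds eq (h ∷ hs) ks O =
    outerOver-sound gs gss c cs n e e′ f f′ mss ds eq h hs ks O
  outerOver-sound (group n₁ e₁ e₁′ f₁ f₁′ ms ∷ gs) gss c@(mark nc ec ec′ fc fc′ wc xc yc) cs n e e′ f f′ mss ds eq h hs ks O =
    [ found , (λ h′ → outerOver-sound gs gss c cs n e e′ f f′ mss ds rest h′ hs ks O) ]′ (∨-elim _ h)
    where
    open Outcome O
    go : Bool
    go = outer w gss (n ℕ.∸ n₁) (e ℕ.+ e₁) (e′ ℕ.+ e₁′) (f ℕ.+ f₁) (f′ ℕ.+ f₁′) (ms ∷ mss)
    first = ∧-conicalˡ (if n₁ ≤ᵇ n then go else true) _ eq
    rest  = ∧-conicalʳ (if n₁ ≤ᵇ n then go else true) _ eq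
    found : ((n₁ ≡ᵇ nc) ∧ (e₁ ≡ᵇ ec) ∧ (e₁′ ≡ᵇ ec′) ∧ (f₁ ≡ᵇ fc) ∧ (f₁′ ≡ᵇ fc′) ∧ hitMember ms wc xc yc) ≡ true → ⊥
    found eqs =
      let n≡  , eqs = ∧-elim (n₁ ≡ᵇ nc) eqs
          e≡  , eqs = ∧-elim (e₁ ≡ᵇ ec) eqs
          e′≡ , eqs = ∧-elim (e₁′ ≡ᵇ ec′) eqs
          f≡  , eqs = ∧-elim (f₁ ≡ᵇ fc) eqs
          f′≡ , hm  = ∧-elim (f₁′ ≡ᵇ fc′) eqs
          n₁≡ = ≡ᵇ-sound n₁ nc n≡
      in outer-sound gss cs (n ℕ.∸ n₁) (e ℕ.+ e₁) (e′ ℕ.+ e₁′) (f ℕ.+ f₁) (f′ ℕ.+ f₁′) (ms ∷ mss) (c ∷ ds)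
           (⇒-elim {n₁ ≤ᵇ n} {go} first (prefix-≤ n₁≡ n-total)) hs (hm ∷ ks)
           record
             { n-total = suffix n₁≡ n-total
             ; e-unit  = shift-unit {e} {ec} {e₁} {e′} {ec′} {e₁′} (≡ᵇ-sound e₁ ec e≡) (≡ᵇ-sound e₁′ ec′ e′≡) e-unit
             ; f-unit  = shift-unit {f} {fc} {f₁} {f′} {fc′} {f₁′} (≡ᵇ-sound f₁ fc f≡) (≡ᵇ-sound f₁′ fc′ f′≡) f-unit
             ; w-total = trans (sym (exchange (total Mark.w ds) wc (total Mark.w cs))) w-total
             ; x-unit  = subst₂ (λ x y → unit x y ≡ true)
                           (exchange (total Mark.x ds) xc (total Mark.x cs)) (exchange (total Mark.y ds) yc (total Mark.y cs)) x-unit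
             }

-- Values at roots of unity

%-≈ : ∀ m n .{{_ : NonZero n}} → + (m % n) ≈ + m [ n ]
%-≈ m n = ≈-sym (+ (m / n) , trans (cong +_ (m≡m%n+[m/n]*n m n)) (cong (_+_ (+ (m % n))) (ℤ.pos-* (m / n) n)))

power-≈ : ∀ g i → + power g i ≈ (+ g) ^ i [ 100000081 ]
power-≈ g zero    = ≈-refl
power-≈ g (suc i) = ≈-trans (%-≈ (g ℕ.* power g i) 100000081)
  (≈-trans (≈-reflexive (ℤ.pos-* g (power g i))) (≈-* (≈-refl {x = + g}) (power-≈ g i)))

power-≤ : ∀ g i → power g i ≤ prime
power-≤ g zero    = s≤s z≤n
power-≤ g (suc i) = ℕ.<⇒≤ (m%n<n (g ℕ.* power g i) 100000081)

digit-≈ : ∀ {a} c → c ≤ prime → a ∈ tern → + digit a c ≈ a * + c [ 100000081 ]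
digit-≈ c c≤q (here refl)                 = ≈-refl
digit-≈ c c≤q (there (here refl))         = ≈-reflexive (sym (ℤ.*-identityˡ (+ c)))
digit-≈ c c≤q (there (there (here refl))) = 1ℤ , lemma (+ (prime ℕ.∸ c)) (+ c) (+ prime) (cong +_ (ℕ.m∸n+n≡m c≤q))
  where
  lemma : ∀ x c q → x + c ≡ q → x ≡ -1ℤ * c + 1ℤ * q
  lemma x c .(x + c) refl = solve x c
    where solve : ∀ x c → x ≡ -1ℤ * c + 1ℤ * (x + c)
          solve = solve-∀

digits-≈ : ∀ n (c : ℕ → ℕ) (a : ℕ → ℤ) → (∀ k → c k ≤ prime) → (∀ k → a k ∈ tern) →
           + digits (applyUpTo c n) (applyUpTo a n) ≈ ∑ n (λ k → a k * + c k) [ 100000081 ]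
digits-≈ zero    c a c≤q a∈ = ≈-refl
digits-≈ (suc n) c a c≤q a∈ = ≈-+ (digit-≈ (c 0) (c≤q 0) (a∈ 0)) (digits-≈ n (c ∘ suc) (a ∘ suc) (c≤q ∘ suc) (a∈ ∘ suc))

evaluate-≈ : ∀ {f} → (∀ i → Ternary (f i)) → ∀ g p →
  + evaluate (powers g p) (column f p) ≈ ∑ 6 (λ k → f (k ℕ.* 10 ℕ.+ p) * (+ g) ^ (k ℕ.* 10 ℕ.+ p)) [ 100000081 ]
evaluate-≈ {f} t g p = ≈-trans (%-≈ (digits (powers g p) (column f p)) 100000081)
  (≈-trans (digits-≈ 6 (λ k → power g (k ℕ.* 10 ℕ.+ p)) (λ k → f (k ℕ.* 10 ℕ.+ p)) (λ k → power-≤ g (k ℕ.* 10 ℕ.+ p)) (λ k → tern-∈ (t (k ℕ.* 10 ℕ.+ p))))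
  (∑-≈ 6 {λ k → f (k ℕ.* 10 ℕ.+ p) * + power g (k ℕ.* 10 ℕ.+ p)} λ k → ≈-* (≈-refl {x = f (k ℕ.* 10 ℕ.+ p)}) (power-≈ g (k ℕ.* 10 ℕ.+ p))))

total-∑ : ∀ h n c → + total h (applyUpTo c n) ≡ ∑ n (λ j → + h (c j))
total-∑ h zero    c = refl
total-∑ h (suc n) c = cong (_+_ (+ h (c 0))) (total-∑ h n (c ∘ suc))

unit-sound : ∀ x y → + x * + y ≈ + 36 [ 100000081 ] → unit x y ≡ true
unit-sound x y eq = close (divides-true 100000081 {+ (x ℕ.* y ℕ.+ 100000045)}
  (≈-trans (≈-+ (≈-trans (≈-reflexive (ℤ.pos-* x y)) eq) (≈-refl {x = + 100000045})) (1ℤ , refl)))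
  where
  opaque
    unfolding unit
    close : divides 100000081 (+ (x ℕ.* y ℕ.+ 100000045)) ≡ true → unit x y ≡ true
    close eq = eq

marks : (ℕ → ℤ) → ℕ → Mark
marks f j = markAt (suc j) (column f (suc j))

module _ {f} (𝓝 : Normal f) where

  open Normal 𝓝

  -- Column 0 is constant. For the bases in use, g¹⁰ has order 3 or 6, so the six terms of this
  -- column cancel, and the nine marks give the whole transform.
  transform-≈ : ∀ g h → (∀ j → h (marks f j) ≡ evaluate (powers g (suc j)) (column f (suc j))) →
                evaluate (powers g 0) (replicate 6 1ℤ) ≡ 0 →
                + total h (applyUpTo (marks f) 9) ≈ ∑ 60 (λ i → f i * (+ g) ^ i) [ 100000081 ]
  transform-≈ g h h≡ zero-col =
    ≈-trans (≈-reflexive (trans (total-∑ h 9 (marks f)) (trans (∑-cong 9 λ j → cong +_ (h≡ j)) pad)))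
    (≈-trans (∑-≈ 10 {λ p → + evaluate (powers g p) (column f p)} (evaluate-≈ ternary g))
    (≈-reflexive (sym (∑-blocks 6 10 (λ i → f i * (+ g) ^ i)))))
    where
    pad : ∑ 9 (λ j → + evaluate (powers g (suc j)) (column f (suc j))) ≡ ∑ 10 (λ p → + evaluate (powers g p) (column f p))
    pad = trans (sym (ℤ.+-identityˡ _)) (cong (λ v → v + ∑ 9 (λ j → + evaluate (powers g (suc j)) (column f (suc j))))
      (cong +_ (sym (trans (cong (evaluate (powers g 0)) ones) zero-col))))

  marks-unit : ∀ g g′ h h′ → power g 60 ≡ 1 → (g ℕ.* g′) % 100000081 ≡ 1 →
    (∀ j → h (marks f j) ≡ evaluate (powers g (suc j)) (column f (suc j))) →
    (∀ j → h′ (marks f j) ≡ evaluate (powers g′ (suc j)) (column f (suc j))) →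
    evaluate (powers g 0) (replicate 6 1ℤ) ≡ 0 → evaluate (powers g′ 0) (replicate 6 1ℤ) ≡ 0 →
    unit (total h (applyUpTo (marks f) 9)) (total h′ (applyUpTo (marks f) 9)) ≡ true
  marks-unit g g′ h h′ g^60≡1 gg′≡1 h≡ h′≡ z z′ = unit-sound _ _
    (≈-trans (≈-* (transform-≈ g h h≡ z) (transform-≈ g′ h′ h′≡ z′))
      (Character.transform-unit isPerfect 100000081 (+ g) (+ g′)
        (≈-trans (≈-sym (power-≈ g 60)) (≈-reflexive (cong +_ g^60≡1)))
        (≈-trans (≈-reflexive (sym (ℤ.pos-* g g′))) (≈-trans (≈-sym (%-≈ (g ℕ.* g′) 100000081)) (≈-reflexive (cong +_ gg′≡1))))))

  e-unit : unit (total Mark.e (applyUpTo (marks f) 9)) (total Mark.e′ (applyUpTo (marks f) 9)) ≡ true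
  e-unit = marks-unit 45715011 96853414 Mark.e Mark.e′ refl refl (λ _ → refl) (λ _ → refl) refl refl
  f-unit : unit (total Mark.f (applyUpTo (marks f) 9)) (total Mark.f′ (applyUpTo (marks f) 9)) ≡ true
  f-unit = marks-unit 65502465 21918428 Mark.f Mark.f′ refl refl (λ _ → refl) (λ _ → refl) refl refl
  x-unit : unit (total Mark.x (applyUpTo (marks f) 9)) (total Mark.y (applyUpTo (marks f) 9)) ≡ true
  x-unit = marks-unit 67157139 23555555 Mark.x Mark.y refl refl (λ _ → refl) (λ _ → refl) refl refl

-- Normal sequences

norm-tail : ∀ n x b → norm (suc n) x ≡ b → ∀ {v} → x 0 ≡ v → norm n (x ∘ suc) ≡ b ℕ.∸ ∣ v ∣ ℕ.* ∣ v ∣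
norm-tail n x b refl refl = sym (ℕ.m+n∸m≡n (∣ x 0 ∣ ℕ.* ∣ x 0 ∣) _)

sumSq-norm : ∀ n x → sumSq (applyUpTo x n) ≡ norm n x
sumSq-norm zero    x = refl
sumSq-norm (suc n) x = cong (ℕ._+_ (∣ x 0 ∣ ℕ.* ∣ x 0 ∣)) (sumSq-norm n (x ∘ suc))

∑-norms : ∀ m d (x : ℕ → ℤ) → ∑ d (λ j → + norm m (λ k → x (k ℕ.* d ℕ.+ j))) ≡ ∑ (m ℕ.* d) (λ i → x i * x i)
∑-norms m d x = trans (∑-cong d λ j → sym (∑-squares m λ k → x (k ℕ.* d ℕ.+ j))) (sym (∑-blocks m d λ i → x i * x i))

module Structure {f} (𝓝 : Normal f) where

  open Normal 𝓝

  B N : ℕ → ℤ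
  B = fold 6 10 1ℤ f
  N = fold 6 10 -1ℤ f

  B-0 : B 0 ≡ + 6
  B-0 = cong (twist 1ℤ) ones

  N-0 : N 0 ≡ 0ℤ
  N-0 = cong (twist -1ℤ) ones

  B-suc : ∀ j → j < 9 → B (suc j) ≡ 0ℤ
  -- `B` has norm 36, and B 0 = 6 takes all of it.
  B-suc = norm-0 9 (B ∘ suc) (norm-tail 9 B 36 (Fold.F-norm isPerfect 6 10 refl 1ℤ refl refl 36 refl) B-0)

  B≈0 : ∀ j → B j ≈ 0ℤ [ 3 ]
  B≈0 = spread 10 (λ j → B j ≈ 0ℤ [ 3 ]) base step
    where
    base : ∀ j → j < 10 → B j ≈ 0ℤ [ 3 ]
    base zero    _         = ≈-trans (≈-reflexive B-0) (+ 2 , refl)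
    base (suc j) (s≤s j<9) = ≈-reflexive (B-suc j j<9)
    step : ∀ j → B j ≈ 0ℤ [ 3 ] → B (10 ℕ.+ j) ≈ 0ℤ [ 3 ]
    step j eq = ≈-trans (≈-reflexive (trans (Fold.F-twisted isPerfect 6 10 refl 1ℤ refl refl j) (ℤ.*-identityˡ (B j)))) eq

  b : ℕ → ℤ
  b j = f j + f (30 ℕ.+ j)

  b≡fold : ∀ j → b j ≡ fold 2 30 1ℤ f j
  b≡fold j = lemma (f j) (f (30 ℕ.+ j))
    where lemma : ∀ x y → x + y ≡ 1ℤ * x + (1ℤ * y + 0ℤ)
          lemma = solve-∀

  b-correlation : ∀ s → autocorrelation 30 b s ≡ ∑ 2 (λ l → 1ℤ ^ l * peak 60 36 (l ℕ.* 30 ℕ.+ s))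
  b-correlation s = trans (∑-cong 30 λ i → cong₂ _*_ (b≡fold i) (b≡fold (s ℕ.+ i)))
                          (Fold.F-correlation isPerfect 2 30 refl 1ℤ refl refl s)

  slopes : ∀ j → j < 10 → b (10 ℕ.+ j) - b j ≈ 0ℤ [ 3 ]
  slopes = Slopes.slope≈0 {b}
    (λ j → ≈-trans (≈-reflexive (triple (f j) (f (10 ℕ.+ j)) (f (20 ℕ.+ j)) (f (30 ℕ.+ j)) (f (40 ℕ.+ j)) (f (50 ℕ.+ j)))) (B≈0 j))
    (λ s → ≈-trans (≈-reflexive (b-correlation s))
      (∑-≈ 2 {y = λ _ → 0ℤ} λ l → ≈-trans (≈-* (≈-refl {x = 1ℤ ^ l}) (peak-≈ {60} {36} (l ℕ.* 30 ℕ.+ s) (+ 12 , refl)))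
                                           (≈-reflexive (ℤ.*-zeroʳ (1ℤ ^ l)))))
    where
    triple : ∀ x₀ x₁ x₂ x₃ x₄ x₅ → (x₀ + x₃) + (x₁ + x₄) + (x₂ + x₅)
             ≡ 1ℤ * x₀ + (1ℤ * x₁ + (1ℤ * x₂ + (1ℤ * x₃ + (1ℤ * x₄ + (1ℤ * x₅ + 0ℤ)))))
    triple = solve-∀

  is-balanced : ∀ j → j < 9 → balanced (column f (suc j)) ≡ true
  is-balanced j j<9 = cong₂ _∧_ (isZero-true {twist 1ℤ (column f (suc j))} (≈-reflexive (B-suc j j<9)))
                                (divides-true 3 (slopes (suc j) (s≤s j<9)))

  -- The sum over the even places of a column. As the column has sum 0, the odd places contribute
  -- the negative, and the alternating sum is twice this.
  M : ℕ → ℤ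
  M j = f (suc j) + f (21 ℕ.+ j) + f (41 ℕ.+ j)

  N≡2M : ∀ j → j < 9 → N (suc j) ≡ M j + M j
  N≡2M j j<9 = trans (lemma (f (suc j)) (f (11 ℕ.+ j)) (f (21 ℕ.+ j)) (f (31 ℕ.+ j)) (f (41 ℕ.+ j)) (f (51 ℕ.+ j)))
    (trans (cong (λ z → M j + M j - z) (B-suc j j<9)) (ℤ.+-identityʳ (M j + M j)))
    where
    lemma : ∀ x₀ x₁ x₂ x₃ x₄ x₅ →
      1ℤ * x₀ + (-1ℤ * x₁ + (1ℤ * x₂ + (-1ℤ * x₃ + (1ℤ * x₄ + (-1ℤ * x₅ + 0ℤ)))))
      ≡ (x₀ + x₂ + x₄) + (x₀ + x₂ + x₄) - (1ℤ * x₀ + (1ℤ * x₁ + (1ℤ * x₂ + (1ℤ * x₃ + (1ℤ * x₄ + (1ℤ * x₅ + 0ℤ))))))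
    lemma = solve-∀

  N-norm : norm 10 N ≡ 36
  N-norm = Fold.F-norm isPerfect 6 10 refl -1ℤ refl refl 36 refl

  M-norm : norm 9 M ≡ 9
  M-norm = ℕ.*-cancelˡ-≡ (norm 9 M) 9 4 (trans (sym (norm-double 9 {M} {N ∘ suc} N≡2M)) (norm-tail 9 N 36 N-norm N-0))

  doubled : 0ℤ ∷ map (λ m → m + m) (applyUpTo M 9) ≡ applyUpTo N 10
  doubled = cong₂ _∷_ (sym N-0) (trans (map-applyUpTo M (λ m → m + m) 9) (applyUpTo-cong< 9 λ j j<9 → sym (N≡2M j j<9)))

  M-flat : flat isZero -1ℤ 9 (0ℤ ∷ map (λ m → m + m) (applyUpTo M 9)) ≡ true
  M-flat = trans (cong (flat isZero -1ℤ 9) doubled)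
    (Fold.F-flat isPerfect 6 10 refl -1ℤ refl refl isZero isZero-true 9 refl (exact N 10))

  M-spectral : magnitudes (applyUpTo M 9) ≡ true
  M-spectral = ⇒-elim {flat isZero -1ℤ 9 (0ℤ ∷ map (λ m → m + m) (applyUpTo M 9))}
    (sphere-sound 3 9 9 spectral spectral-true (ℕ.m≤m+n 10 6) M M-norm) M-flat

  cost-sum : ∑ 9 (λ j → + cost (column f (suc j))) ≡ + 24
  -- Column 0 has pair sums 2, 2, 2, which is 12 of the norm 36 of `b`.
  cost-sum = ∙-cancelˡ (+ 12) _ _ (trans (cong (λ t → + cost t + ∑ 9 (λ j → + cost (column f (suc j)))) (sym ones))
    (trans (∑-cong 10 λ p → cong +_ (sumSq-norm 3 λ k → b (k ℕ.* 10 ℕ.+ p)))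
    (trans (∑-norms 3 10 b) (b-correlation 0))))

  sumSq-sum : ∑ 9 (λ j → + sumSq (column f (suc j))) ≡ + 30
  -- Column 0 holds 6 of the 36 nonzero entries.
  sumSq-sum = ∙-cancelˡ (+ 6) _ _ (trans (cong (λ t → + sumSq t + ∑ 9 (λ j → + sumSq (column f (suc j)))) (sym ones))
    (trans (∑-cong 10 λ p → cong +_ (sumSq-norm 6 λ k → f (k ℕ.* 10 ℕ.+ p)))
    (trans (∑-norms 6 10 f) (correlation 0))))

-- Refutation of normal sequences with a canonical first column

weighted : List ℤ → Bool
weighted t = balanced t ⇒ weight t ℕ.+ (3 ℕ.* (∣ twist -1ℤ t ∣ ℕ.* ∣ twist -1ℤ t ∣) ℕ.+ 10 ℕ.* cost t) ≡ᵇ 18 ℕ.* sumSq t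

abstract
  -- On balanced columns the subtraction in `weight` is never truncated, so weights can be summed as
  -- integers.
  weighted-true : boxes (replicate 6 tern) weighted ≡ true
  weighted-true = refl

refuted-sound : ∀ ts ms → refuted ts ms ≡ true → ∀ i → i < 9 → outer 192 (tables ts i ms) 24 0 0 0 0 [] ≡ true
refuted-sound = unfolded
  where
  opaque
    unfolding refuted
    unfolded : ∀ ts ms → refuted ts ms ≡ true → ∀ i → i < 9 → outer 192 (tables ts i ms) 24 0 0 0 0 [] ≡ true
    unfolded ts ms = below-sound 9 (λ i → outer 192 (tables ts i ms) 24 0 0 0 0 [])

complete-sound : ∀ {f} → (∀ i → Ternary (f i)) → ∀ κ m p → complete κ m p ≡ true →
                 covers κ m p (groups candidates κ m p) (column f p) ≡ true
complete-sound {f} t κ m p = unfolded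
  where
  opaque
    unfolding complete
    unfolded : complete κ m p ≡ true → covers κ m p (groups candidates κ m p) (column f p) ≡ true
    unfolded eq = column-check {f} t (covers κ m p (groups candidates κ m p)) eq p

kind-∈ : ∀ κ → κ ∈ flatK ∷ firstK ∷ anyK ∷ []
kind-∈ flatK  = here refl
kind-∈ firstK = there (here refl)
kind-∈ anyK   = there (there (here refl))

kindAt-holds : ∀ i j t → (j < i → cost t ≡ 0) → (j ≡ i → canonical t ≡ true) → ofKind (kindAt i j) t ≡ true
kindAt-holds i j t flat first with j ℕ.<ᵇ i | ℕ.<ᵇ⇒< j i
... | true  | j<i = ≡ᵇ-true (flat (j<i _))
... | false | _ with j ≡ᵇ i | ℕ.≡ᵇ⇒≡ j i
...   | true  | j≡i = first (j≡i _)
...   | false | _   = refl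

unit-∈ : ∀ v → (∣ v ∣ ≡ᵇ 1) ≡ true → v ∈ tern
unit-∈ (+ 1)    _ = there (here refl)
unit-∈ -[1+ 0 ] _ = there (there (here refl))

magnitude-exact : ∀ m t → twist -1ℤ t ≡ m + m → ofMagnitude m t ≡ true
magnitude-exact m t eq = cong (_∨ (isZero m ∧ (∣ twist -1ℤ t ∣ ≡ᵇ 6)))
  (isZero-true {twist -1ℤ t - (m + m)} (≈-reflexive (ℤ.i≡j⇒i-j≡0 {twist -1ℤ t} {m + m} eq)))

magnitude-0 : ∀ v u → (isZero v ∨ (∣ v ∣ ≡ᵇ 3)) ≡ true → u ≡ v + v → isZero (u - 0ℤ) ∨ (∣ u ∣ ≡ᵇ 6) ≡ true
magnitude-0 (+ 0)    _ _ refl = refl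
magnitude-0 (+ 3)    _ _ refl = refl
magnitude-0 -[1+ 2 ] _ _ refl = refl

module _ {f} (𝓝 : Normal f) where

  open Normal 𝓝
  open Structure 𝓝

  private
    cs : List Mark
    cs = applyUpTo (marks f) 9

    t : ℕ → List ℤ
    t j = column f (suc j)

    alternating : ∑ 9 (λ j → + (∣ twist -1ℤ (t j) ∣ ℕ.* ∣ twist -1ℤ (t j) ∣)) ≡ + 36
    alternating = trans (∑-cong 9 λ j → sym (square (N (suc j))))
      (trans (∑-squares 9 (N ∘ suc)) (cong +_ (norm-tail 9 N 36 N-norm N-0)))

    n-total : total Mark.n cs ≡ 24
    n-total = ℤ.+-injective (trans (total-∑ Mark.n 9 (marks f)) cost-sum)

    w-total : total Mark.w cs ≡ 192
    -- 348 = 3 · 36 + 10 · 24 is the total subtracted from 540 = 18 · 30.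
    w-total = ℤ.+-injective (trans (total-∑ Mark.w 9 (marks f)) (∙-cancelˡ (+ 348) (∑ 9 w) (+ 192) (begin
      + 348 + ∑ 9 w                      ≡⟨ ℤ.+-comm (+ 348) (∑ 9 w) ⟩
      ∑ 9 w + + 348                      ≡⟨ cong (_+_ (∑ 9 w)) rest ⟨
      ∑ 9 w + ∑ 9 r                      ≡⟨ ∑-+ 9 w r ⟨
      ∑ 9 (λ j → w j + r j)              ≡⟨ ∑-cong< 9 local ⟩
      ∑ 9 (λ j → + 18 * + sumSq (t j))   ≡⟨ ∑-*ˡ 9 (+ 18) (λ j → + sumSq (t j)) ⟩
      + 18 * ∑ 9 (λ j → + sumSq (t j))   ≡⟨ cong (+ 18 *_) sumSq-sum ⟩
      + 540                              ∎)))
      where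
      open ≡-Reasoning
      a : ℕ → ℕ
      a j = ∣ twist -1ℤ (t j) ∣ ℕ.* ∣ twist -1ℤ (t j) ∣
      w r : ℕ → ℤ
      w j = + weight (t j)
      r j = + 3 * + a j + + 10 * + cost (t j)
      rest : ∑ 9 r ≡ + 348
      rest = trans (∑-+ 9 (λ j → + 3 * + a j) (λ j → + 10 * + cost (t j))) (cong₂ _+_
        (trans (∑-*ˡ 9 (+ 3) (λ j → + a j)) (cong (+ 3 *_) alternating))
        (trans (∑-*ˡ 9 (+ 10) (λ j → + cost (t j))) (cong (+ 10 *_) cost-sum)))
      local : ∀ j → j < 9 → w j + r j ≡ + 18 * + sumSq (t j)
      local j j<9 = trans (cong (_+_ (w j)) (sym (cong₂ _+_ (ℤ.pos-* 3 (a j)) (ℤ.pos-* 10 (cost (t j))))))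
        (trans (cong +_ (≡ᵇ-sound (weight (t j) ℕ.+ (3 ℕ.* a j ℕ.+ 10 ℕ.* cost (t j))) (18 ℕ.* sumSq (t j))
                 (⇒-elim {balanced (t j)} (column-check {f} ternary weighted weighted-true (suc j)) (is-balanced j j<9))))
               (ℤ.pos-* 18 (sumSq (t j))))

    search : ∀ m → refuted candidates (applyUpTo m 9) ≡ true → (∀ j → j < 9 → m j ∈ tern) →
             (∀ j → j < 9 → ofMagnitude (m j) (t j) ≡ true) →
             ∀ i → i < 9 → (∀ j → j < i → cost (t j) ≡ 0) → canonical (t i) ≡ true → ⊥
    search m ref m∈ mag i i<9 flat first =
      outer-sound 192 (tables candidates i (applyUpTo m 9)) cs 24 0 0 0 0 [] []
        (refuted-sound candidates (applyUpTo m 9) ref i i<9) (pointwise< {R = Hit} 9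
          {λ j → groups candidates (kindAt i j) (at (applyUpTo m 9) j) (suc j)} {marks f} hits) []
        record { n-total = n-total ; e-unit = e-unit 𝓝 ; f-unit = f-unit 𝓝 ; w-total = w-total ; x-unit = x-unit 𝓝 }
      where
      hits : ∀ j → j < 9 → Hit (groups candidates (kindAt i j) (at (applyUpTo m 9) j) (suc j)) (marks f j)
      hits j j<9 = subst (λ v → Hit (groups candidates (kindAt i j) v (suc j)) (marks f j)) (sym (at-applyUpTo m 9 j j<9))
        (⇒-elim {admissible κ (m j) (t j)} (⇒-elim {balanced (t j)} (complete-sound {f} ternary κ (m j) (suc j) complete-here) (is-balanced j j<9))
          (cong₂ _∧_ (kindAt-holds i j (t j) (flat j) (λ { refl → first })) (mag j j<9)))
        where
        κ = kindAt i j
        complete-here : complete κ (m j) (suc j) ≡ true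
        complete-here = all-sound (λ m → complete κ m (suc j)) tern
          (all-sound (λ κ → all (λ m → complete κ m (suc j)) tern) (flatK ∷ firstK ∷ anyK ∷ [])
            (below-sound 9 completeAt complete-true j j<9) (kind-∈ κ)) (m∈ j j<9)

  refute : ∀ i → i < 9 → (∀ j → j < i → cost (column f (suc j)) ≡ 0) → canonical (column f (suc i)) ≡ true → ⊥
  refute = [ (λ eq → search (λ _ → 0ℤ) refuted-0 (λ _ _ → here refl)
               (λ j j<9 → magnitude-0 (M j) (twist -1ℤ (t j)) (all-applyUpTo (λ m → isZero m ∨ (∣ m ∣ ≡ᵇ 3)) M 9 eq j j<9) (N≡2M j j<9)))
           , (λ eq → let units , ref = ∧-elim (all (λ m → ∣ m ∣ ≡ᵇ 1) (applyUpTo M 9)) eq in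
               search M ref (λ j j<9 → unit-∈ (M j) (all-applyUpTo (λ m → ∣ m ∣ ≡ᵇ 1) M 9 units j j<9))
                 (λ j j<9 → magnitude-exact (M j) (t j) (N≡2M j j<9)))
           ]′ (∨-elim (all (λ m → isZero m ∨ (∣ m ∣ ≡ᵇ 3)) (applyUpTo M 9)) M-spectral)

-- Rotation of columns

reaches : ℕ → List ℤ → Bool
reaches zero    t = canonical t
reaches (suc n) t = canonical t ∨ reaches n (rot 1ℤ t)

flat-or-reaches rotation-flat : List ℤ → Bool
flat-or-reaches t = balanced t ⇒ (cost t ≡ᵇ 0) ∨ reaches 5 t
rotation-flat t = (cost t ≡ᵇ 0) ⇒ (cost (rot 1ℤ t) ≡ᵇ 0)

abstract
  flat-or-reaches-true : boxes (replicate 6 tern) flat-or-reaches ≡ true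
  flat-or-reaches-true = refl

  rotation-flat-true : boxes (replicate 6 tern) rotation-flat ≡ true
  rotation-flat-true = refl

module _ {f} (𝓝 : Normal f) where

  open Normal 𝓝

  rot-column : ∀ p → column (λ i → f (10 ℕ.+ i)) p ≡ rot 1ℤ (column f p)
  rot-column p = cong (λ v → f (10 ℕ.+ p) ∷ f (20 ℕ.+ p) ∷ f (30 ℕ.+ p) ∷ f (40 ℕ.+ p) ∷ f (50 ℕ.+ p) ∷ v ∷ [])
    (trans (periodic p) (sym (ℤ.*-identityˡ (f p))))

  advance : Normal (λ i → f (10 ℕ.+ i))
  advance = record { isPerfect = translate 10 isPerfect ; ones = trans (rot-column 0) (cong (rot 1ℤ) ones) }

-- Translation by 10 rotates all columns at once, so it preserves normality and the flatness of the
-- earlier columns; `n` bounds the rotations still needed.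
refute-reaching : ∀ n {f} → Normal f → ∀ i → i < 9 → (∀ j → j < i → cost (column f (suc j)) ≡ 0) →
                  reaches n (column f (suc i)) ≡ true → ⊥
refute-reaching zero        𝓝 i i<9 flat eq = refute 𝓝 i i<9 flat eq
refute-reaching (suc n) {f} 𝓝 i i<9 flat eq =
  [ refute 𝓝 i i<9 flat
  , (λ eq′ → refute-reaching n (advance 𝓝) i i<9
      (λ j j<i → ≡ᵇ-sound _ 0 (trans (cong (λ t → cost t ≡ᵇ 0) (rot-column 𝓝 (suc j)))
        (⇒-elim {cost (column f (suc j)) ≡ᵇ 0} (column-check {f} (Normal.ternary 𝓝) rotation-flat rotation-flat-true (suc j))
                (≡ᵇ-true (flat j j<i)))))
      (trans (cong (reaches n) (rot-column 𝓝 (suc i))) eq′))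
  ]′ (∨-elim (canonical (column f (suc i))) eq)

first-nonzero : ∀ n (h : ℕ → ℕ) → ∑ n (λ j → + h j) ≢ 0ℤ → ∃ λ i → i < n × (∀ j → j < i → h j ≡ 0) × h i ≢ 0
first-nonzero zero    h ≢0 = ⊥-elim (≢0 refl)
first-nonzero (suc n) h ≢0 with h 0 ℕ.≟ 0
... | no  h0≢0 = 0 , s≤s z≤n , (λ _ ()) , h0≢0
... | yes h0≡0 =
  let i , i<n , zeros , hi≢0 = first-nonzero n (h ∘ suc) λ eq → ≢0 (cong₂ _+_ (cong +_ h0≡0) eq)
  in suc i , s≤s i<n , (λ { zero _ → h0≡0 ; (suc j) (s≤s j<i) → zeros j j<i }) , hi≢0

no-normal : ∀ {f} → Normal f → ⊥
no-normal {f} 𝓝 =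
  -- The costs have sum 24, so there is a first column of nonzero cost.
  let i , i<9 , zeros , nonzero = first-nonzero 9 (λ j → cost (column f (suc j)))
        (λ eq → contradiction (trans (sym cost-sum) eq) λ ())
  in [ (λ eq → nonzero (≡ᵇ-sound _ 0 eq)) , refute-reaching 5 𝓝 i i<9 zeros ]′
       (∨-elim (cost (column f (suc i)) ≡ᵇ 0) (⇒-elim {balanced (column f (suc i))}
         (column-check {f} ternary flat-or-reaches flat-or-reaches-true (suc i)) (is-balanced i i<9)))
  where
  open Normal 𝓝
  open Structure 𝓝

no-perfect : ∀ {f} → Perfect 60 36 f → ⊥
no-perfect P = no-normal (proj₂ (normalise P))

mainTheorem3 : ¬ (∃ λ (W : Matrix 60) → IsCirculantWeighing 36 W)
    × ¬ (∃ λ (a : Vector ℤ 60) → IsPerfectTernary 36 a)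
mainTheorem3 = (λ (W , w) → no-perfect (circulant⇒perfect w)) , λ (a , p) → no-perfect (sequence⇒perfect p)
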